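{- Let $g:\{\pm1\}^{m_1}\times\{\pm1\}^{m_2}\to\{\pm1\}$ be a gadget with $\hat g(S,T)=0$ whenever $S=\emptyset$ or $T=\emptyset$. Then for all $k,d,n$, $$L_{1,k}(\mathrm{XOR},d,1,1,n)\le\Bigl(\max_{S,T}|\hat g(S,T)|\Bigr)^{ -k}L_{1,k}(g,d,m_1,m_2,n)\le 2^{(m_1+m_2)k/2}L_{1,k}(g,d,m_1,m_2,n).$$
   Context: $\hat g(S,T)=\mathbb{E}[g(\mathbf{x},\mathbf{y})\prod_{j\in S}\mathbf{x}_j\prod_{j\in T}\mathbf{y}_j]$ for uniform $\mathbf{x}\in\{\pm1\}^{m_1},\mathbf{y}\in\{\pm1\}^{m_2}$. For a randomized two-party protocol $\mathcal{C}:(\{\pm1\}^{m_1})^n\times(\{\pm1\}^{m_2})^n\to[-1,1]$ (value = expected output over internal randomness; inputs are $n$ blocks $x_i\in\{\pm1\}^{m_1}$, $y_i\in\{\pm1\}^{m_2}$), its $g$-fiber is $\mathcal{C}_{\downarrow g}(z)=\mathbb{E}[\mathcal{C}(\mathbf{x},\mathbf{y})\mid g(\mathbf{x}_i,\mathbf{y}_i)=z_i\ \forall i]$ for uniform $\mathbf{x},\mathbf{y}$. For $f:\{\pm1\}^n\to\mathbb{R}$, $L_{1,k}(f)=\sum_{|I|=k}|\hat f(I)|$. $L_{1,k}(g,d,m_1,m_2,n)$ denotes the supremum of $L_{1,k}(\mathcal{C}_{\downarrow g})$ over all such randomized protocols with at most $d$ bits of communication. $\mathrm{XOR}:\{\pm1\}\times\{\pm1\}\to\{\pm1\}$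 is the gadget $\mathrm{XOR}(a,b)=ab$ (so $m_1=m_2=1$). -}

module Defs where

open import Algebra.Bundles using (CommutativeRing; Semiring)
open import Data.Bool.Base using (Bool)
open import Data.Fin.Base using (Fin)
open import Data.Fin.Subset using (Subset; ∣_∣; inside; outside)
open import Data.List.Base using (List; []; _∷_; map; foldr; length; filter; cartesianProduct; cartesianProductWith)
import Data.List.Extrema as Extrema
open import Data.Nat.Base using (ℕ; zero; suc)
import Data.Nat.Properties as ℕ
open import Data.Product.Base using (∃; _×_; _,_; uncurry)
open import Data.Sign as Sign using (Sign)
open import Data.Vec.Base using (Vec; []; _∷_; zipWith)
import Data.Vec.Properties as Vec
open import Level using (0ℓ)
open import Relation.Binary.Bundles using (TotalOrder)
open import Relation.Binary.Structures using (IsTotalOrder)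
open import Relation.Nullary.Negation.Core using (¬_)
open import Relation.Unary using (Pred; Satisfiable)

------------------------------------------------------------------------
-- The real numbers, axiomatised as a Dedekind-complete ordered field.
--
-- These are the classical reals: completeness is for arbitrary predicates.
-- Inverse and supremum are total operations, but nothing is assumed about
-- the inverse of zero or the supremum of an empty or unbounded predicate.

record Reals : Set₁ where
  field
    commutativeRing : CommutativeRing 0ℓ 0ℓ

  open CommutativeRing commutativeRing public

  infix  4 _≤_
  infixl 9 _⁻¹

  field
    0≉1          : ¬ (0# ≈ 1#)
    _⁻¹          : Carrier → Carrier
    ⁻¹-cong      : ∀ {x y} → x ≈ y → x ⁻¹ ≈ y ⁻¹
    *-inverseʳ   : ∀ {x} → ¬ (x ≈ 0#) → x * x ⁻¹ ≈ 1#
    _≤_          : Carrier → Carrier → Set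
    isTotalOrder : IsTotalOrder _≈_ _≤_
    +-monoˡ-≤    : ∀ {x y} z → x ≤ y → x + z ≤ y + z
    *-nonNeg     : ∀ {x y} → 0# ≤ x → 0# ≤ y → 0# ≤ x * y

  UpperBound : Pred Carrier 0ℓ → Carrier → Set
  UpperBound P b = ∀ {x} → P x → x ≤ b

  field
    sup       : Pred Carrier 0ℓ → Carrier
    sup-upper : ∀ {P} → ∃ (UpperBound P) → UpperBound P (sup P)
    sup-least : ∀ {P b} → Satisfiable P → UpperBound P b → sup P ≤ b

  totalOrder : TotalOrder 0ℓ 0ℓ 0ℓ
  totalOrder = record { isTotalOrder = isTotalOrder }

------------------------------------------------------------------------
-- Cubes {±1}ᵐ, with Sign playing the role of {±1}

vectors : ∀ {A : Set} → List A → ∀ n → List (Vec A n)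
vectors as zero    = [] ∷ []
vectors as (suc n) = cartesianProductWith _∷_ as (vectors as n)

Cube : ℕ → Set
Cube m = Vec Sign m

cube : ∀ m → List (Cube m)
cube = vectors (Sign.+ ∷ Sign.- ∷ [])

subsets : ∀ m → List (Subset m)
subsets = vectors (outside ∷ inside ∷ [])

-- χ S x = ∏_{j ∈ S} xⱼ
χ : ∀ {m} → Subset m → Cube m → Sign
χ []            []      = Sign.+
χ (inside  ∷ S) (a ∷ x) = a Sign.* χ S x
χ (outside ∷ S) (_ ∷ x) = χ S x

Gadget : ℕ → ℕ → Set
Gadget m₁ m₂ = Cube m₁ → Cube m₂ → Sign

XOR : Gadget 1 1
XOR (a ∷ []) (b ∷ []) = a Sign.* b

-- n blocks of m coordinates
Blocks : ℕ → ℕ → Set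
Blocks n m = Vec (Cube m) n

blocks : ∀ n m → List (Blocks n m)
blocks n m = vectors (cube m) n

-- The pairs (x , y) of block inputs with g (xᵢ , yᵢ) = zᵢ for all i
fiber : ∀ {m₁ m₂ n} → Gadget m₁ m₂ → Cube n → List (Blocks n m₁ × Blocks n m₂)
fiber {m₁} {m₂} {n} g z =
  filter (λ (x , y) → Vec.≡-dec Sign._≟_ (zipWith g x y) z)
         (cartesianProduct (blocks n m₁) (blocks n m₂))

------------------------------------------------------------------------
-- Deterministic protocols on X × Y exchanging at most d bits: at each step
-- the speaker sends one bit depending on their own input (and, through the
-- position in the tree, on the transcript so far).  The output is a function
-- of the transcript.

data Protocol (X Y : Set) : ℕ → Set where
  output : ∀ {d} → Sign → Protocol X Y d
  alice  : ∀ {d} → (X → Bool) → (Bool → Protocol X Y d) → Protocol X Y (suc d)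
  bob    : ∀ {d} → (Y → Bool) → (Bool → Protocol X Y d) → Protocol X Y (suc d)

run : ∀ {X Y d} → Protocol X Y d → X → Y → Sign
run (output s)    x y = s
run (alice bit p) x y = run (p (bit x)) x y
run (bob   bit p) x y = run (p (bit y)) x y

------------------------------------------------------------------------

module Analysis (ℝ : Reals) where
  open Reals ℝ
  open import Algebra.Definitions.RawSemiring (Semiring.rawSemiring semiring) public
    using (_^_) renaming (_×_ to _·_; sum to ∑Fin)

  2# : Carrier
  2# = 1# + 1#

  -- The square root of x ≥ 0
  √_ : Carrier → Carrier
  √ x = sup (λ y → y * y ≤ x)

  ∣_∣ᵣ : Carrier → Carrier
  ∣ x ∣ᵣ = Extrema.max totalOrder x (- x ∷ [])

  ⟦_⟧ : Sign → Carrier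
  ⟦ Sign.+ ⟧ = 1#
  ⟦ Sign.- ⟧ = - 1#

  ∑ : ∀ {A : Set} → List A → (A → Carrier) → Carrier
  ∑ as f = foldr _+_ 0# (map f as)

  -- Expectation under the uniform distribution on the list
  𝔼 : ∀ {A : Set} → List A → (A → Carrier) → Carrier
  𝔼 as f = ∑ as f * (length as · 1#) ⁻¹

  fourier : ∀ {n} → (Cube n → Carrier) → Subset n → Carrier
  fourier {n} f I = 𝔼 (cube n) (λ z → f z * ⟦ χ I z ⟧)

  gadgetFourier : ∀ {m₁ m₂} → Gadget m₁ m₂ → Subset m₁ → Subset m₂ → Carrier
  gadgetFourier {m₁} {m₂} g S T =
    𝔼 (cartesianProduct (cube m₁) (cube m₂))
      (λ (x , y) → ⟦ g x y ⟧ * ⟦ χ S x ⟧ * ⟦ χ T y ⟧)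

  -- max_{S,T} |ĝ(S,T)|; starting the maximum at 0 is harmless as absolute
  -- values are nonnegative.
  maxFourier : ∀ {m₁ m₂} → Gadget m₁ m₂ → Carrier
  maxFourier {m₁} {m₂} g =
    Extrema.max totalOrder 0#
      (map (λ (S , T) → ∣ gadgetFourier g S T ∣ᵣ)
           (cartesianProduct (subsets m₁) (subsets m₂)))

  L₁ : ∀ {n} → ℕ → (Cube n → Carrier) → Carrier
  L₁ {n} k f = ∑ (filter (λ I → ∣ I ∣ ℕ.≟ k) (subsets n)) (λ I → ∣ fourier f I ∣ᵣ)

  -- A randomized protocol is a probability distribution, with real weights,
  -- over deterministic protocols.  Finite support loses nothing: on finite
  -- inputs there are only finitely many deterministic protocols of given cost
  -- up to the function they compute.
  record RandomizedProtocol (X Y : Set) (d : ℕ) : Set where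
    field
      size          : ℕ
      weight        : Fin size → Carrier
      weight-nonNeg : ∀ ω → 0# ≤ weight ω
      weight-total  : ∑Fin weight ≈ 1#
      protocol      : Fin size → Protocol X Y d

    -- expected output
    value : X → Y → Carrier
    value x y = ∑Fin (λ ω → weight ω * ⟦ run (protocol ω) x y ⟧)

  open RandomizedProtocol public using (value)

  -- The conditional expectation; if g is constant some fibers are empty, and
  -- the empty sum makes gFiber zero there.
  gFiber : ∀ {m₁ m₂ n} → Gadget m₁ m₂ →
           (Blocks n m₁ → Blocks n m₂ → Carrier) → Cube n → Carrier
  gFiber g C z = 𝔼 (fiber g z) (uncurry C)

  -- L_{1,k}(g, d, m₁, m₂, n)
  L₁-sup : ℕ → ∀ {m₁ m₂} → Gadget m₁ m₂ → ℕ → ℕ → Carrier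
  L₁-sup k {m₁} {m₂} g d n =
    sup (λ v → ∃ λ (C : RandomizedProtocol (Blocks n m₁) (Blocks n m₂) d) →
                 v ≈ L₁ k (gFiber g (value C)))

-- Let (S , T) maximise |ĝ(S,T)|.  By hypothesis S and T are nonempty, so for a
-- uniform input (u , v) of g the parities χ_S(u) and χ_T(v) are independent
-- uniform bits, and the conditional expectation of g(u,v) given them is
-- ĝ(S,T) χ_S(u) χ_T(v), the terms with S = ∅ or T = ∅ being zero.  Hence running
-- a protocol C for XOR on the blockwise parities gives, at the same cost, a
-- protocol whose g-fiber has Fourier coefficients ĝ(S,T)^|I| times those of the
-- XOR-fiber of C, which is the first inequality.  The second follows from
-- Parseval: the 2^(m₁+m₂) squares ĝ(S,T)² sum to 1, so the largest is at least
-- 2^-(m₁+m₂).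

module Submission where

open import Data.Fin.Subset using (Subset; ⊥)
open import Data.Nat.Base as ℕ using (ℕ)
open import Data.Product.Base using (_×_)
open import Data.Sum.Base using (_⊎_)
open import Relation.Binary.PropositionalEquality using (_≡_)
open import Defs

open import Relation.Binary.Bundles using (TotalOrder)
open import Data.Bool.Base using (Bool; true; false; if_then_else_; _∧_)
open import Data.Fin.Base using (Fin)
open import Data.Fin.Subset using (∣_∣; inside; outside)
open import Data.List.Base using (List; []; _∷_; _++_; map; filter; length; cartesianProduct; cartesianProductWith)
import Data.List.Extrema as Extrema
open import Data.List.Membership.Propositional.Properties using (∈-map⁻)
open import Data.List.Relation.Unary.All as All using (All; []; _∷_)
import Data.List.Relation.Unary.All.Properties as All
import Data.Nat.Properties as ℕ
open import Data.Product.Base using (∃; ∃₂; _,_; proj₁; proj₂; uncurry)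
open import Data.Sign as Sign using (Sign)
open import Data.Sum.Base using (inj₁; inj₂; [_,_]′)
open import Data.Vec.Base as Vec using (Vec; []; _∷_; zipWith)
import Data.Vec.Properties as Vec
open import Function.Base using (_∘_; id)
open import Relation.Binary.PropositionalEquality as ≡ using ()
open import Relation.Nullary.Decidable.Core using (does; yes; no)
open import Relation.Nullary.Negation.Core using (¬_; contradiction)
open import Relation.Unary using (Decidable)

-- Parseval serves both inequalities: besides bounding the maximum from below it shows that the
-- maximum is nonzero. Only then does its inverse mean anything, and only then is it attained at a
-- pair (S , T) with nonzero coefficient, which is what rules out an empty S or T. The conditioning
-- in the g-fiber disappears because ĝ(∅,∅) = 0 makes g balanced: all 2^n fibers have the same size,
-- so the coefficient at I is the plain expectation of C(x,y) times the product of g(xᵢ,yᵢ) over i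
-- in I, and the blocks can be treated one at a time. Inverses are controlled only at nonzero
-- arguments, so most of the argument runs on unnormalised sums, with powers of 2 on both sides in
-- place of divisions. The suprema bring obligations of their own: the values for g must be bounded
-- above, or `sup` says nothing about them, and their supremum must be nonnegative before the bound
-- on the inverse maximum can be multiplied by it.

-- Order, inverses, square roots and absolute values

module OrderedField (ℝ : Reals) where
  open Reals ℝ
  open Analysis ℝ
  open TotalOrder totalOrder using (poset; total; antisym)
    renaming (refl to ≤-refl; reflexive to ≤-reflexive; trans to ≤-trans)
  open import Algebra.Properties.Ring ring
  open import Algebra.Solver.Ring.NaturalCoefficients.Default commutativeSemiring
    using (solve; _:=_; _:*_)
  open import Relation.Binary.Reasoning.PartialOrder poset

  +-monoʳ-≤ : ∀ {x y} z → x ≤ y → z + x ≤ z + y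
  +-monoʳ-≤ {x} {y} z x≤y = begin
    z + x  ≈⟨ +-comm z x ⟩
    x + z  ≤⟨ +-monoˡ-≤ z x≤y ⟩
    y + z  ≈⟨ +-comm y z ⟩
    z + y  ∎

  +-mono-≤ : ∀ {x y u v} → x ≤ y → u ≤ v → x + u ≤ y + v
  +-mono-≤ {y = y} {u} x≤y u≤v = ≤-trans (+-monoˡ-≤ u x≤y) (+-monoʳ-≤ y u≤v)

  +-nonNeg : ∀ {x y} → 0# ≤ x → 0# ≤ y → 0# ≤ x + y
  +-nonNeg 0≤x 0≤y = ≤-trans (≤-reflexive (sym (+-identityˡ 0#))) (+-mono-≤ 0≤x 0≤y)

  -‿anti-≤ : ∀ {x y} → x ≤ y → - y ≤ - x
  -‿anti-≤ {x} {y} x≤y = begin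
    - y              ≈⟨ +-identityˡ (- y) ⟨
    0# + - y         ≈⟨ +-congʳ (-‿inverseˡ x) ⟨
    - x + x + - y    ≤⟨ +-monoˡ-≤ (- y) (+-monoʳ-≤ (- x) x≤y) ⟩
    - x + y + - y    ≈⟨ +-assoc (- x) y (- y) ⟩
    - x + (y + - y)  ≈⟨ +-congˡ (-‿inverseʳ y) ⟩
    - x + 0#         ≈⟨ +-identityʳ (- x) ⟩
    - x              ∎

  x≤0⇒0≤-x : ∀ {x} → x ≤ 0# → 0# ≤ - x
  x≤0⇒0≤-x x≤0 = ≤-trans (≤-reflexive (sym -0#≈0#)) (-‿anti-≤ x≤0)

  -x*-y≈x*y : ∀ x y → - x * - y ≈ x * y
  -x*-y≈x*y x y = begin-equality
    - x * - y      ≈⟨ -‿distribˡ-* x (- y) ⟨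
    - (x * - y)    ≈⟨ -‿cong (-‿distribʳ-* x y) ⟨
    - (- (x * y))  ≈⟨ -‿involutive (x * y) ⟩
    x * y          ∎

  x*x-nonNeg : ∀ x → 0# ≤ x * x
  x*x-nonNeg x with total 0# x
  ... | inj₁ 0≤x = *-nonNeg 0≤x 0≤x
  ... | inj₂ x≤0 = ≤-trans (*-nonNeg 0≤-x 0≤-x) (≤-reflexive (-x*-y≈x*y x x))
    where 0≤-x = x≤0⇒0≤-x x≤0

  0≤1 : 0# ≤ 1#
  0≤1 = ≤-trans (x*x-nonNeg 1#) (≤-reflexive (*-identityˡ 1#))

  *-monoˡ-≤ : ∀ {x y z} → 0# ≤ z → x ≤ y → z * x ≤ z * y
  *-monoˡ-≤ {x} {y} {z} 0≤z x≤y = begin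
    z * x                    ≈⟨ +-identityʳ (z * x) ⟨
    z * x + 0#               ≤⟨ +-monoʳ-≤ (z * x) (*-nonNeg 0≤z 0≤y-x) ⟩
    z * x + z * (y + - x)    ≈⟨ distribˡ z x (y + - x) ⟨
    z * (x + (y + - x))      ≈⟨ *-congˡ (+-assoc x y (- x)) ⟨
    z * (x + y + - x)        ≈⟨ *-congˡ (xyx⁻¹≈y x y) ⟩
    z * y                    ∎
    where
    0≤y-x : 0# ≤ y + - x
    0≤y-x = ≤-trans (≤-reflexive (sym (-‿inverseʳ x))) (+-monoˡ-≤ (- x) x≤y)

  *-monoʳ-≤ : ∀ {x y z} → 0# ≤ z → x ≤ y → x * z ≤ y * z
  *-monoʳ-≤ {x} {y} {z} 0≤z x≤y = begin
    x * z  ≈⟨ *-comm x z ⟩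
    z * x  ≤⟨ *-monoˡ-≤ 0≤z x≤y ⟩
    z * y  ≈⟨ *-comm z y ⟩
    y * z  ∎

  *-mono-≤ : ∀ {x y u v} → 0# ≤ x → 0# ≤ v → x ≤ y → u ≤ v → x * u ≤ y * v
  *-mono-≤ 0≤x 0≤v x≤y u≤v = ≤-trans (*-monoˡ-≤ 0≤x u≤v) (*-monoʳ-≤ 0≤v x≤y)

  ^-nonNeg : ∀ {x} k → 0# ≤ x → 0# ≤ x ^ k
  ^-nonNeg ℕ.zero    0≤x = 0≤1
  ^-nonNeg (ℕ.suc k) 0≤x = *-nonNeg 0≤x (^-nonNeg k 0≤x)

  ^-monoˡ-≤ : ∀ {x y} k → 0# ≤ x → x ≤ y → x ^ k ≤ y ^ k
  ^-monoˡ-≤ ℕ.zero    0≤x x≤y = ≤-refl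
  ^-monoˡ-≤ (ℕ.suc k) 0≤x x≤y =
    *-mono-≤ 0≤x (^-nonNeg k (≤-trans 0≤x x≤y)) x≤y (^-monoˡ-≤ k 0≤x x≤y)

  1^ : ∀ k → 1# ^ k ≈ 1#
  1^ ℕ.zero    = refl
  1^ (ℕ.suc k) = trans (*-identityˡ (1# ^ k)) (1^ k)

  1≤⇒≉0 : ∀ {x} → 1# ≤ x → ¬ (x ≈ 0#)
  1≤⇒≉0 1≤x x≈0 = 0≉1 (antisym 0≤1 (≤-trans 1≤x (≤-reflexive x≈0)))

  1≤2 : 1# ≤ 2#
  1≤2 = ≤-trans (≤-reflexive (sym (+-identityʳ 1#))) (+-monoʳ-≤ 1# 0≤1)

  1≤2^ : ∀ k → 1# ≤ 2# ^ k
  1≤2^ k = ≤-trans (≤-reflexive (sym (1^ k))) (^-monoˡ-≤ k 0≤1 1≤2)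

  2^≉0 : ∀ k → ¬ (2# ^ k ≈ 0#)
  2^≉0 k = 1≤⇒≉0 (1≤2^ k)

  *-inverseˡ : ∀ {x} → ¬ (x ≈ 0#) → x ⁻¹ * x ≈ 1#
  *-inverseˡ {x} x≉0 = trans (*-comm (x ⁻¹) x) (*-inverseʳ x≉0)

  ⁻¹-unique : ∀ {x y} → ¬ (x ≈ 0#) → x * y ≈ 1# → y ≈ x ⁻¹
  ⁻¹-unique {x} {y} x≉0 xy≈1 = begin-equality
    y               ≈⟨ *-identityˡ y ⟨
    1# * y          ≈⟨ *-congʳ (*-inverseˡ x≉0) ⟨
    x ⁻¹ * x * y    ≈⟨ *-assoc (x ⁻¹) x y ⟩
    x ⁻¹ * (x * y)  ≈⟨ *-congˡ xy≈1 ⟩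
    x ⁻¹ * 1#       ≈⟨ *-identityʳ (x ⁻¹) ⟩
    x ⁻¹            ∎

  *-≉0ˡ : ∀ {x y} → ¬ (x * y ≈ 0#) → ¬ (x ≈ 0#)
  *-≉0ˡ {x} {y} xy≉0 x≈0 = xy≉0 (trans (*-congʳ x≈0) (zeroˡ y))

  ⁻¹-distrib-* : ∀ {x y} → ¬ (x * y ≈ 0#) → x ⁻¹ * y ⁻¹ ≈ (x * y) ⁻¹
  ⁻¹-distrib-* {x} {y} xy≉0 = ⁻¹-unique xy≉0 (begin-equality
    x * y * (x ⁻¹ * y ⁻¹)
      ≈⟨ solve 4 (λ a b c d → a :* b :* (c :* d) := a :* c :* (b :* d)) refl x y (x ⁻¹) (y ⁻¹) ⟩
    x * x ⁻¹ * (y * y ⁻¹)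
      ≈⟨ *-cong (*-inverseʳ (*-≉0ˡ xy≉0))
                (*-inverseʳ (*-≉0ˡ (λ yx≈0 → xy≉0 (trans (*-comm x y) yx≈0)))) ⟩
    1# * 1#
      ≈⟨ *-identityˡ 1# ⟩
    1# ∎)

  -- The inverse of x is x times the square of that inverse.
  ⁻¹-nonNeg : ∀ {x} → ¬ (x ≈ 0#) → 0# ≤ x → 0# ≤ x ⁻¹
  ⁻¹-nonNeg {x} x≉0 0≤x = begin
    0#                  ≤⟨ *-nonNeg 0≤x (x*x-nonNeg (x ⁻¹)) ⟩
    x * (x ⁻¹ * x ⁻¹)   ≈⟨ *-assoc x (x ⁻¹) (x ⁻¹) ⟨
    x * x ⁻¹ * x ⁻¹     ≈⟨ *-congʳ (*-inverseʳ x≉0) ⟩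
    1# * x ⁻¹           ≈⟨ *-identityˡ (x ⁻¹) ⟩
    x ⁻¹                ∎

  *-cancelˡ-≤ : ∀ {x y z} → ¬ (z ≈ 0#) → 0# ≤ z → z * x ≤ z * y → x ≤ y
  *-cancelˡ-≤ {x} {y} {z} z≉0 0≤z zx≤zy = begin
    x               ≈⟨ *-identityˡ x ⟨
    1# * x          ≈⟨ *-congʳ (*-inverseˡ z≉0) ⟨
    z ⁻¹ * z * x    ≈⟨ *-assoc (z ⁻¹) z x ⟩
    z ⁻¹ * (z * x)  ≤⟨ *-monoˡ-≤ (⁻¹-nonNeg z≉0 0≤z) zx≤zy ⟩
    z ⁻¹ * (z * y)  ≈⟨ *-assoc (z ⁻¹) z y ⟨
    z ⁻¹ * z * y    ≈⟨ *-congʳ (*-inverseˡ z≉0) ⟩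
    1# * y          ≈⟨ *-identityˡ y ⟩
    y               ∎

  -- The root is a supremum, so its defining set has to be bounded: x + 1 is a bound, since t ≤ 1 or
  -- else t ≤ t² ≤ x.
  y≤√x : ∀ {x y} → 0# ≤ x → y * y ≤ x → y ≤ √ x
  y≤√x {x} 0≤x y²≤x = sup-upper (x + 1# , bounded) y²≤x
    where
    bounded : ∀ {t} → t * t ≤ x → t ≤ x + 1#
    bounded {t} t²≤x with total t 1#
    ... | inj₁ t≤1 = begin
      t        ≤⟨ t≤1 ⟩
      1#       ≈⟨ +-identityˡ 1# ⟨
      0# + 1#  ≤⟨ +-monoˡ-≤ 1# 0≤x ⟩
      x + 1#   ∎
    ... | inj₂ 1≤t = begin
      t        ≈⟨ *-identityʳ t ⟨
      t * 1#   ≤⟨ *-monoˡ-≤ (≤-trans 0≤1 1≤t) 1≤t ⟩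
      t * t    ≤⟨ t²≤x ⟩
      x        ≈⟨ +-identityʳ x ⟨
      x + 0#   ≤⟨ +-monoʳ-≤ x 0≤1 ⟩
      x + 1#   ∎

  x≤∣x∣ : ∀ x → x ≤ ∣ x ∣ᵣ
  x≤∣x∣ x = Extrema.⊥≤max totalOrder x (- x ∷ [])

  -x≤∣x∣ : ∀ x → - x ≤ ∣ x ∣ᵣ
  -x≤∣x∣ x with Extrema.xs≤max totalOrder x (- x ∷ [])
  ... | -x≤ ∷ [] = -x≤

  ∣x∣≤ : ∀ {x b} → x ≤ b → - x ≤ b → ∣ x ∣ᵣ ≤ b
  ∣x∣≤ x≤b -x≤b = Extrema.max≤v⁺ totalOrder x≤b (-x≤b ∷ [])

  ∣x∣-nonNeg : ∀ x → 0# ≤ ∣ x ∣ᵣ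
  ∣x∣-nonNeg x with total 0# x
  ... | inj₁ 0≤x = ≤-trans 0≤x (x≤∣x∣ x)
  ... | inj₂ x≤0 = ≤-trans (x≤0⇒0≤-x x≤0) (-x≤∣x∣ x)

  ∣∣-cong : ∀ {x y} → x ≈ y → ∣ x ∣ᵣ ≈ ∣ y ∣ᵣ
  ∣∣-cong {x} {y} x≈y = antisym (le x≈y) (le (sym x≈y))
    where
    le : ∀ {x y} → x ≈ y → ∣ x ∣ᵣ ≤ ∣ y ∣ᵣ
    le {x} {y} x≈y = ∣x∣≤ (≤-trans (≤-reflexive x≈y) (x≤∣x∣ y))
                          (≤-trans (≤-reflexive (-‿cong x≈y)) (-x≤∣x∣ y))

  ∣x∣≈x⊎∣x∣≈-x : ∀ x → ∣ x ∣ᵣ ≈ x ⊎ ∣ x ∣ᵣ ≈ - x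
  ∣x∣≈x⊎∣x∣≈-x x =
    [ (λ x≤-x → inj₂ (antisym (∣x∣≤ x≤-x ≤-refl) (-x≤∣x∣ x)))
    , (λ -x≤x → inj₁ (antisym (∣x∣≤ ≤-refl -x≤x) (x≤∣x∣ x)))
    ]′ (total x (- x))

  ∣-x∣≈∣x∣ : ∀ x → ∣ - x ∣ᵣ ≈ ∣ x ∣ᵣ
  ∣-x∣≈∣x∣ x = antisym
    (∣x∣≤ (-x≤∣x∣ x) (≤-trans (≤-reflexive (-‿involutive x)) (x≤∣x∣ x)))
    (∣x∣≤ (≤-trans (≤-reflexive (sym (-‿involutive x))) (-x≤∣x∣ (- x))) (x≤∣x∣ (- x)))

  0≤x⇒∣x∣≈x : ∀ {x} → 0# ≤ x → ∣ x ∣ᵣ ≈ x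
  0≤x⇒∣x∣≈x {x} 0≤x = antisym (∣x∣≤ ≤-refl -x≤x) (x≤∣x∣ x)
    where
    -x≤x : - x ≤ x
    -x≤x = ≤-trans (≤-trans (-‿anti-≤ 0≤x) (≤-reflexive -0#≈0#)) 0≤x

  -- The two products agree up to sign, so they have the same absolute value, and the one on the
  -- right is nonnegative.
  ∣∣-* : ∀ x y → ∣ x * y ∣ᵣ ≈ ∣ x ∣ᵣ * ∣ y ∣ᵣ
  ∣∣-* x y = trans xy≈ (0≤x⇒∣x∣≈x (*-nonNeg (∣x∣-nonNeg x) (∣x∣-nonNeg y)))
    where
    xy≈ : ∣ x * y ∣ᵣ ≈ ∣ ∣ x ∣ᵣ * ∣ y ∣ᵣ ∣ᵣ
    xy≈ with ∣x∣≈x⊎∣x∣≈-x x | ∣x∣≈x⊎∣x∣≈-x y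
    ... | inj₁ p | inj₁ q = ∣∣-cong (sym (*-cong p q))
    ... | inj₂ p | inj₂ q = ∣∣-cong (sym (trans (*-cong p q) (-x*-y≈x*y x y)))
    ... | inj₁ p | inj₂ q = sym (trans (∣∣-cong (trans (*-cong p q) (sym (-‿distribʳ-* x y)))) (∣-x∣≈∣x∣ (x * y)))
    ... | inj₂ p | inj₁ q = sym (trans (∣∣-cong (trans (*-cong p q) (sym (-‿distribˡ-* x y)))) (∣-x∣≈∣x∣ (x * y)))

  ∣∣-^ : ∀ x k → ∣ x ^ k ∣ᵣ ≈ ∣ x ∣ᵣ ^ k
  ∣∣-^ x ℕ.zero    = 0≤x⇒∣x∣≈x 0≤1
  ∣∣-^ x (ℕ.suc k) = trans (∣∣-* x (x ^ k)) (*-congˡ (∣∣-^ x k))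

  ∣x∣²≈x² : ∀ x → ∣ x ∣ᵣ * ∣ x ∣ᵣ ≈ x * x
  ∣x∣²≈x² x = trans (sym (∣∣-* x x)) (0≤x⇒∣x∣≈x (x*x-nonNeg x))

  ∣x+y∣≤∣x∣+∣y∣ : ∀ x y → ∣ x + y ∣ᵣ ≤ ∣ x ∣ᵣ + ∣ y ∣ᵣ
  ∣x+y∣≤∣x∣+∣y∣ x y = ∣x∣≤ (+-mono-≤ (x≤∣x∣ x) (x≤∣x∣ y))
    (≤-trans (≤-reflexive (sym (-‿+-comm x y))) (+-mono-≤ (-x≤∣x∣ x) (-x≤∣x∣ y)))

-- Finite sums, double sums and indicators

module Sums (ℝ : Reals) where
  open Reals ℝ
  open Analysis ℝ
  open OrderedField ℝ
  open TotalOrder totalOrder using (poset)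
    renaming (refl to ≤-refl; reflexive to ≤-reflexive; trans to ≤-trans)
  open import Algebra.Solver.Ring.NaturalCoefficients.Default commutativeSemiring
    using (solve; _:=_; _:+_)
  open import Relation.Binary.Reasoning.PartialOrder poset

  private variable
    A B C D : Set

  ∑-cong : ∀ (as : List A) {f h : A → Carrier} → (∀ a → f a ≈ h a) → ∑ as f ≈ ∑ as h
  ∑-cong []       f≈h = refl
  ∑-cong (a ∷ as) f≈h = +-cong (f≈h a) (∑-cong as f≈h)

  ∑-mono : ∀ (as : List A) {f h : A → Carrier} → All (λ a → f a ≤ h a) as → ∑ as f ≤ ∑ as h
  ∑-mono []       []          = ≤-refl
  ∑-mono (a ∷ as) (f≤h ∷ fs≤) = +-mono-≤ f≤h (∑-mono as fs≤)

  ∑-0 : ∀ (as : List A) → ∑ as (λ _ → 0#) ≈ 0#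
  ∑-0 []       = refl
  ∑-0 (a ∷ as) = trans (+-identityˡ _) (∑-0 as)

  ∑-1 : ∀ (as : List A) → ∑ as (λ _ → 1#) ≈ length as · 1#
  ∑-1 []       = refl
  ∑-1 (a ∷ as) = +-congˡ (∑-1 as)

  ∑-+ : ∀ (as : List A) (f h : A → Carrier) → ∑ as (λ a → f a + h a) ≈ ∑ as f + ∑ as h
  ∑-+ []       f h = sym (+-identityˡ 0#)
  ∑-+ (a ∷ as) f h = trans (+-congˡ (∑-+ as f h))
    (solve 4 (λ w x y z → (w :+ x) :+ (y :+ z) := (w :+ y) :+ (x :+ z)) refl (f a) (h a) (∑ as f) (∑ as h))

  ∑-*ˡ : ∀ (as : List A) c (f : A → Carrier) → ∑ as (λ a → c * f a) ≈ c * ∑ as f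
  ∑-*ˡ []       c f = sym (zeroʳ c)
  ∑-*ˡ (a ∷ as) c f = trans (+-congˡ (∑-*ˡ as c f)) (sym (distribˡ c (f a) (∑ as f)))

  ∑-*ʳ : ∀ (as : List A) c (f : A → Carrier) → ∑ as (λ a → f a * c) ≈ ∑ as f * c
  ∑-*ʳ as c f = trans (∑-cong as (λ a → *-comm (f a) c)) (trans (∑-*ˡ as c f) (*-comm c (∑ as f)))

  ∑-const : ∀ (as : List A) c → ∑ as (λ _ → c) ≈ c * ∑ as (λ _ → 1#)
  ∑-const as c = trans (∑-cong as (λ _ → sym (*-identityʳ c))) (∑-*ˡ as c (λ _ → 1#))

  ∑-swap : ∀ (as : List A) (bs : List B) (f : A → B → Carrier) →
           ∑ as (λ a → ∑ bs (f a)) ≈ ∑ bs (λ b → ∑ as (λ a → f a b))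
  ∑-swap []       bs f = sym (∑-0 bs)
  ∑-swap (a ∷ as) bs f =
    trans (+-congˡ (∑-swap as bs f)) (sym (∑-+ bs (f a) (λ b → ∑ as (λ a → f a b))))

  ∑-++ : ∀ (as bs : List A) (f : A → Carrier) → ∑ (as ++ bs) f ≈ ∑ as f + ∑ bs f
  ∑-++ []       bs f = sym (+-identityˡ _)
  ∑-++ (a ∷ as) bs f = trans (+-congˡ (∑-++ as bs f)) (sym (+-assoc (f a) (∑ as f) (∑ bs f)))

  ∑-map : ∀ (as : List A) (t : A → B) (f : B → Carrier) → ∑ (map t as) f ≈ ∑ as (f ∘ t)
  ∑-map []       t f = refl
  ∑-map (a ∷ as) t f = +-congˡ (∑-map as t f)

  ∑-cartesianProductWith : ∀ (_⊗_ : A → B → C) as bs (f : C → Carrier) →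
    ∑ (cartesianProductWith _⊗_ as bs) f ≈ ∑ as (λ a → ∑ bs (λ b → f (a ⊗ b)))
  ∑-cartesianProductWith _⊗_ []       bs f = refl
  ∑-cartesianProductWith _⊗_ (a ∷ as) bs f =
    trans (∑-++ (map (a ⊗_) bs) _ f)
          (+-cong (∑-map bs (a ⊗_) f) (∑-cartesianProductWith _⊗_ as bs f))

  ∑-vectors : ∀ (as : List A) n (f : Vec A (ℕ.suc n) → Carrier) →
    ∑ (vectors as (ℕ.suc n)) f ≈ ∑ as (λ a → ∑ (vectors as n) (λ v → f (a ∷ v)))
  ∑-vectors as n f = ∑-cartesianProductWith _∷_ as (vectors as n) f

  𝟙 : Bool → Carrier
  𝟙 b = if b then 1# else 0#

  𝟙-∧ : ∀ b c → 𝟙 (b ∧ c) ≈ 𝟙 b * 𝟙 c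
  𝟙-∧ true  c = sym (*-identityˡ (𝟙 c))
  𝟙-∧ false c = sym (zeroˡ (𝟙 c))

  -- Turns a sum over a fiber, whose domain depends on z, into a weighted sum over all inputs, which
  -- can then be exchanged with the sum over z.
  ∑-filter : ∀ {P : A → Set} (P? : Decidable P) as (f : A → Carrier) →
             ∑ (filter P? as) f ≈ ∑ as (λ a → 𝟙 (does (P? a)) * f a)
  ∑-filter P? []       f = refl
  ∑-filter P? (a ∷ as) f with does (P? a)
  ... | true  = +-cong (sym (*-identityˡ (f a))) (∑-filter P? as f)
  ... | false = trans (∑-filter P? as f) (sym (trans (+-congʳ (zeroˡ (f a))) (+-identityˡ _)))

  -- The comparison may use the proof of `P a`: at level k this replaces the exponent `∣ I ∣` by k,
  -- so that the power can leave the sum.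
  ∑-filter-cong : ∀ {P : A → Set} (P? : Decidable P) as {f h : A → Carrier} →
                  (∀ a → P a → f a ≈ h a) → ∑ (filter P? as) f ≈ ∑ (filter P? as) h
  ∑-filter-cong P? []       f≈h = refl
  ∑-filter-cong P? (a ∷ as) f≈h with P? a
  ... | yes p = +-cong (f≈h a p) (∑-filter-cong P? as f≈h)
  ... | no  _ = ∑-filter-cong P? as f≈h

  ∣∑∣≤∑∣∣ : ∀ (as : List A) (f : A → Carrier) → ∣ ∑ as f ∣ᵣ ≤ ∑ as (λ a → ∣ f a ∣ᵣ)
  ∣∑∣≤∑∣∣ []       f = ≤-reflexive (0≤x⇒∣x∣≈x ≤-refl)
  ∣∑∣≤∑∣∣ (a ∷ as) f = ≤-trans (∣x+y∣≤∣x∣+∣y∣ (f a) (∑ as f)) (+-monoʳ-≤ ∣ f a ∣ᵣ (∣∑∣≤∑∣∣ as f))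

  ∑-nonNeg : ∀ (as : List A) {f : A → Carrier} → (∀ a → 0# ≤ f a) → 0# ≤ ∑ as f
  ∑-nonNeg []       0≤f = ≤-refl
  ∑-nonNeg (a ∷ as) 0≤f = +-nonNeg (0≤f a) (∑-nonNeg as 0≤f)

  ∑₂ : List A → List B → (A → B → Carrier) → Carrier
  ∑₂ as bs f = ∑ as (λ a → ∑ bs (f a))

  ∑-cartesianProduct : ∀ (as : List A) (bs : List B) (f : A × B → Carrier) →
    ∑ (cartesianProduct as bs) f ≈ ∑₂ as bs (λ a b → f (a , b))
  ∑-cartesianProduct = ∑-cartesianProductWith _,_

  module _ (as : List A) (bs : List B) where

    ∑₂-cong : ∀ {f h : A → B → Carrier} → (∀ a b → f a b ≈ h a b) → ∑₂ as bs f ≈ ∑₂ as bs h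
    ∑₂-cong f≈h = ∑-cong as (λ a → ∑-cong bs (f≈h a))

    ∑₂-+ : ∀ (f h : A → B → Carrier) → ∑₂ as bs (λ a b → f a b + h a b) ≈ ∑₂ as bs f + ∑₂ as bs h
    ∑₂-+ f h = trans (∑-cong as (λ a → ∑-+ bs (f a) (h a))) (∑-+ as _ _)

    ∑₂-*ˡ : ∀ c (f : A → B → Carrier) → ∑₂ as bs (λ a b → c * f a b) ≈ c * ∑₂ as bs f
    ∑₂-*ˡ c f = trans (∑-cong as (λ a → ∑-*ˡ bs c (f a))) (∑-*ˡ as c _)

    ∑₂-*ʳ : ∀ c (f : A → B → Carrier) → ∑₂ as bs (λ a b → f a b * c) ≈ ∑₂ as bs f * c
    ∑₂-*ʳ c f = trans (∑-cong as (λ a → ∑-*ʳ bs c (f a))) (∑-*ʳ as c _)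

    ∑₂-product : ∀ (f : A → Carrier) (h : B → Carrier) → ∑₂ as bs (λ a b → f a * h b) ≈ ∑ as f * ∑ bs h
    ∑₂-product f h = trans (∑-cong as (λ a → ∑-*ˡ bs (f a) h)) (∑-*ʳ as (∑ bs h) f)

    ∑-∑₂-swap : ∀ (cs : List C) (f : C → A → B → Carrier) →
      ∑ cs (λ c → ∑₂ as bs (f c)) ≈ ∑₂ as bs (λ a b → ∑ cs (λ c → f c a b))
    ∑-∑₂-swap cs f = trans (∑-swap cs as (λ c a → ∑ bs (f c a)))
                           (∑-cong as (λ a → ∑-swap cs bs (λ c → f c a)))

    ∑₂-swap : ∀ (cs : List C) (ds : List D) (f : A → B → C → D → Carrier) →
      ∑₂ as bs (λ a b → ∑₂ cs ds (f a b)) ≈ ∑₂ cs ds (λ c d → ∑₂ as bs (λ a b → f a b c d))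
    ∑₂-swap cs ds f = trans (sym (∑-∑₂-swap cs (λ c a b → ∑ ds (f a b c))))
                            (∑-cong cs (λ c → sym (∑-∑₂-swap ds (λ d a b → f a b c d))))

    -- Peels the first block off both inputs at once, for the inductions on n. An exchange is needed
    -- because unfolding alone sums Alice's later blocks before Bob's first.
    ∑₂-vectors : ∀ n (f : Vec A (ℕ.suc n) → Vec B (ℕ.suc n) → Carrier) →
      ∑₂ (vectors as (ℕ.suc n)) (vectors bs (ℕ.suc n)) f ≈
      ∑₂ as bs (λ a b → ∑₂ (vectors as n) (vectors bs n) (λ v w → f (a ∷ v) (b ∷ w)))
    ∑₂-vectors n f = trans (∑-vectors as n _) (∑-cong as (λ a →
      trans (∑-cong (vectors as n) (λ v → ∑-vectors bs n (f (a ∷ v))))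
            (∑-swap (vectors as n) bs _)))

  signs : List Sign
  signs = Sign.+ ∷ Sign.- ∷ []

  ∑-𝟙-sign : ∀ a (h : Sign → Carrier) → ∑ signs (λ b → 𝟙 (does (a Sign.≟ b)) * h b) ≈ h a
  ∑-𝟙-sign Sign.+ h = trans (+-cong (*-identityˡ _) (trans (+-identityʳ _) (zeroˡ _))) (+-identityʳ _)
  ∑-𝟙-sign Sign.- h = trans (+-cong (zeroˡ _) (trans (+-identityʳ _) (*-identityˡ _))) (+-identityˡ _)

  -- Used with w = `zipWith g x y`: each input lies over exactly one z, so a sum over all fibers
  -- meets it once.
  ∑-𝟙-cube : ∀ {n} (w : Cube n) (h : Cube n → Carrier) →
             ∑ (cube n) (λ z → 𝟙 (does (Vec.≡-dec Sign._≟_ w z)) * h z) ≈ h w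
  ∑-𝟙-cube []      h = trans (+-identityʳ _) (*-identityˡ (h []))
  ∑-𝟙-cube {ℕ.suc n} (a ∷ w) h = begin-equality
    ∑ (cube (ℕ.suc n)) (λ z → 𝟙 (does (Vec.≡-dec Sign._≟_ (a ∷ w) z)) * h z)
      ≈⟨ ∑-vectors signs n (λ z → 𝟙 (does (Vec.≡-dec Sign._≟_ (a ∷ w) z)) * h z) ⟩
    ∑ signs (λ b → ∑ (cube n) (λ z → 𝟙 (does (a Sign.≟ b) ∧ does (Vec.≡-dec Sign._≟_ w z)) * h (b ∷ z)))
      ≈⟨ ∑-cong signs (λ b →
           trans (∑-cong (cube n) (λ z → trans (*-congʳ (𝟙-∧ (does (a Sign.≟ b)) _)) (*-assoc _ _ _)))
                 (trans (∑-*ˡ (cube n) _ _) (*-congˡ (∑-𝟙-cube w (λ z → h (b ∷ z)))))) ⟩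
    ∑ signs (λ b → 𝟙 (does (a Sign.≟ b)) * h (b ∷ w))
      ≈⟨ ∑-𝟙-sign a (λ b → h (b ∷ w)) ⟩
    h (a ∷ w) ∎

-- Characters, and the fibers of a balanced gadget

module Fibers (ℝ : Reals) where
  open Reals ℝ
  open Analysis ℝ
  open OrderedField ℝ
  open Sums ℝ
  open TotalOrder totalOrder using (poset)
    renaming (reflexive to ≤-reflexive; trans to ≤-trans)
  open import Algebra.Properties.Ring ring
  open import Algebra.Properties.CommutativeSemiring.Exp commutativeSemiring
    using (^-congˡ; ^-homo-*)
  open import Algebra.Solver.Ring.NaturalCoefficients.Default commutativeSemiring
    using (solve; _:=_; _:*_)
  open import Relation.Binary.Reasoning.PartialOrder poset

  ⟦⟧-* : ∀ s t → ⟦ s Sign.* t ⟧ ≈ ⟦ s ⟧ * ⟦ t ⟧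
  ⟦⟧-* Sign.+ t      = sym (*-identityˡ ⟦ t ⟧)
  ⟦⟧-* Sign.- Sign.+ = sym (*-identityʳ (- 1#))
  ⟦⟧-* Sign.- Sign.- = sym (trans (-x*-y≈x*y 1# 1#) (*-identityˡ 1#))

  ⟦⟧²≈1 : ∀ s → ⟦ s ⟧ * ⟦ s ⟧ ≈ 1#
  ⟦⟧²≈1 Sign.+ = *-identityˡ 1#
  ⟦⟧²≈1 Sign.- = trans (-x*-y≈x*y 1# 1#) (*-identityˡ 1#)

  ∣⟦⟧∣≈1 : ∀ s → ∣ ⟦ s ⟧ ∣ᵣ ≈ 1#
  ∣⟦⟧∣≈1 Sign.+ = 0≤x⇒∣x∣≈x 0≤1
  ∣⟦⟧∣≈1 Sign.- = trans (∣-x∣≈∣x∣ 1#) (0≤x⇒∣x∣≈x 0≤1)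

  -- The Fourier expansion of equality on signs, with the factor 2 kept on the left in place of a
  -- division.
  2*𝟙-≟ : ∀ s t → 2# * 𝟙 (does (s Sign.≟ t)) ≈ 1# + ⟦ s ⟧ * ⟦ t ⟧
  2*𝟙-≟ Sign.+ Sign.+ = trans (*-identityʳ 2#) (+-congˡ (sym (*-identityˡ 1#)))
  2*𝟙-≟ Sign.- Sign.- = trans (*-identityʳ 2#) (+-congˡ (sym (⟦⟧²≈1 Sign.-)))
  2*𝟙-≟ Sign.+ Sign.- =
    trans (zeroʳ 2#) (sym (trans (+-congˡ (*-identityˡ (- 1#))) (-‿inverseʳ 1#)))
  2*𝟙-≟ Sign.- Sign.+ =
    trans (zeroʳ 2#) (sym (trans (+-congˡ (*-identityʳ (- 1#))) (-‿inverseʳ 1#)))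

  χ-⊥ : ∀ {m} (x : Cube m) → χ ⊥ x ≡ Sign.+
  χ-⊥ []      = ≡.refl
  χ-⊥ (_ ∷ x) = χ-⊥ x

  ∑-signs : ∑ signs ⟦_⟧ ≈ 0#
  ∑-signs = trans (+-congˡ (+-identityʳ (- 1#))) (-‿inverseʳ 1#)

  -- Flipping a coordinate that lies in S negates the character, so the two halves of the cube
  -- cancel.
  S≡⊥⊎∑χ≈0 : ∀ {m} (S : Subset m) → S ≡ ⊥ ⊎ ∑ (cube m) (λ x → ⟦ χ S x ⟧) ≈ 0#
  S≡⊥⊎∑χ≈0 []            = inj₁ ≡.refl
  S≡⊥⊎∑χ≈0 {ℕ.suc m} (inside ∷ S) = inj₂ (begin-equality
    ∑ (cube (ℕ.suc m)) (λ x → ⟦ χ (inside ∷ S) x ⟧)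
      ≈⟨ ∑-vectors signs m (λ x → ⟦ χ (inside ∷ S) x ⟧) ⟩
    ∑₂ signs (cube m) (λ a x → ⟦ a Sign.* χ S x ⟧)
      ≈⟨ ∑₂-cong signs (cube m) (λ a x → ⟦⟧-* a (χ S x)) ⟩
    ∑₂ signs (cube m) (λ a x → ⟦ a ⟧ * ⟦ χ S x ⟧)
      ≈⟨ ∑₂-product signs (cube m) ⟦_⟧ (λ x → ⟦ χ S x ⟧) ⟩
    ∑ signs ⟦_⟧ * ∑ (cube m) (λ x → ⟦ χ S x ⟧)
      ≈⟨ *-congʳ ∑-signs ⟩
    0# * ∑ (cube m) (λ x → ⟦ χ S x ⟧)
      ≈⟨ zeroˡ _ ⟩
    0# ∎)
  S≡⊥⊎∑χ≈0 {ℕ.suc m} (outside ∷ S) with S≡⊥⊎∑χ≈0 S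
  ... | inj₁ S≡⊥  = inj₁ (≡.cong (outside ∷_) S≡⊥)
  ... | inj₂ ∑χ≈0 = inj₂ (trans (∑-vectors signs m (λ x → ⟦ χ (outside ∷ S) x ⟧))
                            (trans (∑-cong signs (λ _ → ∑χ≈0)) (∑-0 signs)))

  ∑-vectors-1 : ∀ {A : Set} (as : List A) n → ∑ (vectors as n) (λ _ → 1#) ≈ ∑ as (λ _ → 1#) ^ n
  ∑-vectors-1 as ℕ.zero    = +-identityʳ 1#
  ∑-vectors-1 as (ℕ.suc n) = begin-equality
    ∑ (vectors as (ℕ.suc n)) (λ _ → 1#)
      ≈⟨ ∑-vectors as n (λ _ → 1#) ⟩
    ∑₂ as (vectors as n) (λ _ _ → 1#)
      ≈⟨ ∑₂-cong as (vectors as n) (λ _ _ → sym (*-identityˡ 1#)) ⟩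
    ∑₂ as (vectors as n) (λ _ _ → 1# * 1#)
      ≈⟨ ∑₂-product as (vectors as n) (λ _ → 1#) (λ _ → 1#) ⟩
    ∑ as (λ _ → 1#) * ∑ (vectors as n) (λ _ → 1#)
      ≈⟨ *-congˡ (∑-vectors-1 as n) ⟩
    ∑ as (λ _ → 1#) * ∑ as (λ _ → 1#) ^ n ∎

  -- The alphabets are arbitrary two-element lists because the same count serves pairs of inputs and
  -- pairs (S , T).
  ∑-pairs-1 : ∀ {A B : Set} (a a′ : A) (b b′ : B) m₁ m₂ →
    ∑₂ (vectors (a ∷ a′ ∷ []) m₁) (vectors (b ∷ b′ ∷ []) m₂) (λ _ _ → 1#) ≈ 2# ^ (m₁ ℕ.+ m₂)
  ∑-pairs-1 a a′ b b′ m₁ m₂ = begin-equality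
    ∑₂ as bs (λ _ _ → 1#)                      ≈⟨ ∑₂-cong as bs (λ _ _ → sym (*-identityˡ 1#)) ⟩
    ∑₂ as bs (λ _ _ → 1# * 1#)                 ≈⟨ ∑₂-product as bs (λ _ → 1#) (λ _ → 1#) ⟩
    ∑ as (λ _ → 1#) * ∑ bs (λ _ → 1#)          ≈⟨ *-cong (count a a′ m₁) (count b b′ m₂) ⟩
    2# ^ m₁ * 2# ^ m₂                          ≈⟨ ^-homo-* 2# m₁ m₂ ⟨
    2# ^ (m₁ ℕ.+ m₂)                           ∎
    where
    as = vectors (a ∷ a′ ∷ []) m₁
    bs = vectors (b ∷ b′ ∷ []) m₂
    count : ∀ {A : Set} (a a′ : A) m → ∑ (vectors (a ∷ a′ ∷ []) m) (λ _ → 1#) ≈ 2# ^ m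
    count a a′ m = trans (∑-vectors-1 (a ∷ a′ ∷ []) m) (^-congˡ m (+-congˡ (+-identityʳ 1#)))

  ∑-cubes : ∀ m₁ m₂ → ∑₂ (cube m₁) (cube m₂) (λ _ _ → 1#) ≈ 2# ^ (m₁ ℕ.+ m₂)
  ∑-cubes = ∑-pairs-1 Sign.+ Sign.- Sign.+ Sign.-

  length-cube : ∀ n → length (cube n) · 1# ≈ 2# ^ n
  length-cube n = trans (sym (∑-1 (cube n)))
    (trans (∑-vectors-1 signs n) (^-congˡ n (+-congˡ (+-identityʳ 1#))))

  length-cubes : ∀ m₁ m₂ → length (cartesianProduct (cube m₁) (cube m₂)) · 1# ≈ 2# ^ (m₁ ℕ.+ m₂)
  length-cubes m₁ m₂ = trans (sym (∑-1 cubes))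
    (trans (∑-cartesianProduct (cube m₁) (cube m₂) (λ _ → 1#)) (∑-cubes m₁ m₂))
    where cubes = cartesianProduct (cube m₁) (cube m₂)

  module _ {m₁ m₂} (g : Gadget m₁ m₂) where

    -- Divided by the number of inputs, this is the expectation of F times the product of g(xᵢ,yᵢ)
    -- over i in I.
    correlation : ∀ {n} → (Blocks n m₁ → Blocks n m₂ → Carrier) → Subset n → Carrier
    correlation {n} F I =
      ∑₂ (blocks n m₁) (blocks n m₂) (λ x y → F x y * ⟦ χ I (zipWith g x y) ⟧)

    ∑-fiber : ∀ {n} (z : Cube n) F →
      ∑ (fiber g z) F ≈
      ∑₂ (blocks n m₁) (blocks n m₂) (λ x y → 𝟙 (does (Vec.≡-dec Sign._≟_ (zipWith g x y) z)) * F (x , y))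
    ∑-fiber {n} z F =
      trans (∑-filter (λ (x , y) → Vec.≡-dec Sign._≟_ (zipWith g x y) z)
                      (cartesianProduct (blocks n m₁) (blocks n m₂)) F)
            (∑-cartesianProduct (blocks n m₁) (blocks n m₂) _)

    -- This is ĝ(∅,∅) = 0 without the normalisation.
    Balanced : Set
    Balanced = ∑₂ (cube m₁) (cube m₂) (λ u v → ⟦ g u v ⟧) ≈ 0#

    module _ (balanced : Balanced) where

      -- By `2*𝟙-≟` the indicator splits into a constant and a multiple of g; the latter sums to
      -- zero, so g takes each value on half of the inputs.
      2*∑-𝟙-g : ∀ c → 2# * ∑₂ (cube m₁) (cube m₂) (λ u v → 𝟙 (does (g u v Sign.≟ c))) ≈ 2# ^ (m₁ ℕ.+ m₂)
      2*∑-𝟙-g c = begin-equality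
        2# * ∑₂ (cube m₁) (cube m₂) (λ u v → 𝟙 (does (g u v Sign.≟ c)))
          ≈⟨ ∑₂-*ˡ (cube m₁) (cube m₂) 2# _ ⟨
        ∑₂ (cube m₁) (cube m₂) (λ u v → 2# * 𝟙 (does (g u v Sign.≟ c)))
          ≈⟨ ∑₂-cong (cube m₁) (cube m₂) (λ u v → 2*𝟙-≟ (g u v) c) ⟩
        ∑₂ (cube m₁) (cube m₂) (λ u v → 1# + ⟦ g u v ⟧ * ⟦ c ⟧)
          ≈⟨ ∑₂-+ (cube m₁) (cube m₂) _ _ ⟩
        ∑₂ (cube m₁) (cube m₂) (λ _ _ → 1#) + ∑₂ (cube m₁) (cube m₂) (λ u v → ⟦ g u v ⟧ * ⟦ c ⟧)
          ≈⟨ +-cong (∑-cubes m₁ m₂) (trans (∑₂-*ʳ (cube m₁) (cube m₂) ⟦ c ⟧ _) (trans (*-congʳ balanced) (zeroˡ ⟦ c ⟧))) ⟩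
        2# ^ (m₁ ℕ.+ m₂) + 0#
          ≈⟨ +-identityʳ _ ⟩
        2# ^ (m₁ ℕ.+ m₂) ∎

      -- The indicator of a fiber is a product over the blocks, and each block halves the count by
      -- `2*∑-𝟙-g`.
      ∑-𝟙-fiber : ∀ {n} (z : Cube n) →
        2# ^ n * ∑₂ (blocks n m₁) (blocks n m₂) (λ x y → 𝟙 (does (Vec.≡-dec Sign._≟_ (zipWith g x y) z))) ≈
        (2# ^ (m₁ ℕ.+ m₂)) ^ n
      ∑-𝟙-fiber [] = trans (*-identityˡ _) (trans (+-identityʳ _) (+-identityʳ 1#))
      ∑-𝟙-fiber {ℕ.suc n} (c ∷ z) = begin-equality
        2# ^ ℕ.suc n * ∑₂ (blocks (ℕ.suc n) m₁) (blocks (ℕ.suc n) m₂) (λ x y → 𝟙 (does (Vec.≡-dec Sign._≟_ (zipWith g x y) (c ∷ z))))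
          ≈⟨ *-congˡ (∑₂-vectors (cube m₁) (cube m₂) n _) ⟩
        2# ^ ℕ.suc n * ∑₂ (cube m₁) (cube m₂) (λ u v → ∑₂ (blocks n m₁) (blocks n m₂) (λ x y →
          𝟙 (does (g u v Sign.≟ c) ∧ does (Vec.≡-dec Sign._≟_ (zipWith g x y) z))))
          ≈⟨ *-congˡ (∑₂-cong (cube m₁) (cube m₂) (λ u v →
               trans (∑₂-cong (blocks n m₁) (blocks n m₂) (λ x y → 𝟙-∧ (does (g u v Sign.≟ c)) _))
                     (∑₂-*ˡ (blocks n m₁) (blocks n m₂) _ _))) ⟩
        2# ^ ℕ.suc n * ∑₂ (cube m₁) (cube m₂) (λ u v → 𝟙 (does (g u v Sign.≟ c)) * rest)
          ≈⟨ *-congˡ (∑₂-*ʳ (cube m₁) (cube m₂) rest _) ⟩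
        2# * 2# ^ n * (first * rest)
          ≈⟨ solve 4 (λ w x y t → w :* x :* (y :* t) := w :* y :* (x :* t)) refl 2# (2# ^ n) first rest ⟩
        2# * first * (2# ^ n * rest)
          ≈⟨ *-cong (2*∑-𝟙-g c) (∑-𝟙-fiber z) ⟩
        2# ^ (m₁ ℕ.+ m₂) * (2# ^ (m₁ ℕ.+ m₂)) ^ n ∎
        where
        first = ∑₂ (cube m₁) (cube m₂) (λ u v → 𝟙 (does (g u v Sign.≟ c)))
        rest = ∑₂ (blocks n m₁) (blocks n m₂) (λ x y → 𝟙 (does (Vec.≡-dec Sign._≟_ (zipWith g x y) z)))

      length-fiber : ∀ {n} (z : Cube n) →
        (length (fiber g z) · 1#) * 2# ^ n ≈ (2# ^ (m₁ ℕ.+ m₂)) ^ n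
      length-fiber {n} z = begin-equality
        (length (fiber g z) · 1#) * 2# ^ n
          ≈⟨ *-comm _ _ ⟩
        2# ^ n * (length (fiber g z) · 1#)
          ≈⟨ *-congˡ (∑-1 (fiber g z)) ⟨
        2# ^ n * ∑ (fiber g z) (λ _ → 1#)
          ≈⟨ *-congˡ (trans (∑-fiber z (λ _ → 1#)) (∑₂-cong (blocks n m₁) (blocks n m₂) (λ _ _ → *-identityʳ _))) ⟩
        2# ^ n * ∑₂ (blocks n m₁) (blocks n m₂) (λ x y → 𝟙 (does (Vec.≡-dec Sign._≟_ (zipWith g x y) z)))
          ≈⟨ ∑-𝟙-fiber z ⟩
        (2# ^ (m₁ ℕ.+ m₂)) ^ n ∎

      total≉0 : ∀ n → ¬ ((2# ^ (m₁ ℕ.+ m₂)) ^ n ≈ 0#)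
      total≉0 n = 1≤⇒≉0 (≤-trans (≤-reflexive (sym (1^ n))) (^-monoˡ-≤ n 0≤1 (1≤2^ (m₁ ℕ.+ m₂))))

      -- The fibers all have the same size, so a uniform point of a uniform
      -- fiber is a uniform input.
      fourier-gFiber : ∀ {n} (F : Blocks n m₁ → Blocks n m₂ → Carrier) I →
        fourier (gFiber g F) I ≈ correlation F I * ((2# ^ (m₁ ℕ.+ m₂)) ^ n) ⁻¹
      fourier-gFiber {n} F I = begin-equality
        ∑ (cube n) (λ z → ∑ (fiber g z) (uncurry F) * (length (fiber g z) · 1#) ⁻¹ * ⟦ χ I z ⟧) * (length (cube n) · 1#) ⁻¹
          ≈⟨ *-congˡ (⁻¹-cong (length-cube n)) ⟩
        ∑ (cube n) (λ z → ∑ (fiber g z) (uncurry F) * (length (fiber g z) · 1#) ⁻¹ * ⟦ χ I z ⟧) * (2# ^ n) ⁻¹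
          ≈⟨ ∑-*ʳ (cube n) _ _ ⟨
        ∑ (cube n) (λ z → ∑ (fiber g z) (uncurry F) * (length (fiber g z) · 1#) ⁻¹ * ⟦ χ I z ⟧ * (2# ^ n) ⁻¹)
          ≈⟨ ∑-cong (cube n) normalise ⟩
        ∑ (cube n) (λ z → ∑₂ (blocks n m₁) (blocks n m₂) (λ x y → (𝟙 (does (Vec.≡-dec Sign._≟_ (zipWith g x y) z)) * F x y) * ⟦ χ I z ⟧) * c ⁻¹)
          ≈⟨ ∑-*ʳ (cube n) (c ⁻¹) _ ⟩
        ∑ (cube n) (λ z → ∑₂ (blocks n m₁) (blocks n m₂) (λ x y → (𝟙 (does (Vec.≡-dec Sign._≟_ (zipWith g x y) z)) * F x y) * ⟦ χ I z ⟧)) * c ⁻¹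
          ≈⟨ *-congʳ (∑-∑₂-swap (blocks n m₁) (blocks n m₂) (cube n) _) ⟩
        ∑₂ (blocks n m₁) (blocks n m₂) (λ x y → ∑ (cube n) (λ z → (𝟙 (does (Vec.≡-dec Sign._≟_ (zipWith g x y) z)) * F x y) * ⟦ χ I z ⟧)) * c ⁻¹
          ≈⟨ *-congʳ (∑₂-cong (blocks n m₁) (blocks n m₂) (λ x y →
               trans (∑-cong (cube n) (λ z → *-assoc _ (F x y) ⟦ χ I z ⟧))
                     (∑-𝟙-cube (zipWith g x y) (λ z → F x y * ⟦ χ I z ⟧)))) ⟩
        correlation F I * c ⁻¹ ∎
        where
        c = (2# ^ (m₁ ℕ.+ m₂)) ^ n
        normalise : ∀ z →
          ∑ (fiber g z) (uncurry F) * (length (fiber g z) · 1#) ⁻¹ * ⟦ χ I z ⟧ * (2# ^ n) ⁻¹ ≈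
          ∑₂ (blocks n m₁) (blocks n m₂) (λ x y → (𝟙 (does (Vec.≡-dec Sign._≟_ (zipWith g x y) z)) * F x y) * ⟦ χ I z ⟧) * c ⁻¹
        normalise z = begin-equality
          ∑ (fiber g z) (uncurry F) * N ⁻¹ * ⟦ χ I z ⟧ * (2# ^ n) ⁻¹
            ≈⟨ solve 4 (λ w x y t → w :* x :* y :* t := w :* y :* (x :* t)) refl (∑ (fiber g z) (uncurry F)) (N ⁻¹) ⟦ χ I z ⟧ ((2# ^ n) ⁻¹) ⟩
          ∑ (fiber g z) (uncurry F) * ⟦ χ I z ⟧ * (N ⁻¹ * (2# ^ n) ⁻¹)
            -- `N * 2# ^ n` is the number of all inputs, whatever z is. It is nonzero, so no fiber
            -- is empty and the two inverses merge into one that does not depend on z.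
            ≈⟨ *-cong (*-congʳ (∑-fiber z (uncurry F)))
                      (trans (⁻¹-distrib-* (λ N≈0 → total≉0 n (trans (sym (length-fiber z)) N≈0)))
                             (⁻¹-cong (length-fiber z))) ⟩
          ∑₂ (blocks n m₁) (blocks n m₂) (λ x y → 𝟙 (does (Vec.≡-dec Sign._≟_ (zipWith g x y) z)) * F x y) * ⟦ χ I z ⟧ * c ⁻¹
            ≈⟨ *-congʳ (∑₂-*ʳ (blocks n m₁) (blocks n m₂) ⟦ χ I z ⟧ _) ⟨
          ∑₂ (blocks n m₁) (blocks n m₂) (λ x y → (𝟙 (does (Vec.≡-dec Sign._≟_ (zipWith g x y) z)) * F x y) * ⟦ χ I z ⟧) * c ⁻¹ ∎
          where N = length (fiber g z) · 1#

-- Replacing XOR by g through blockwise parities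

module Lifting (ℝ : Reals) where
  open Reals ℝ
  open Analysis ℝ
  open OrderedField ℝ
  open Sums ℝ
  open Fibers ℝ
  open TotalOrder totalOrder using (poset)
  open import Algebra.Solver.Ring.NaturalCoefficients.Default commutativeSemiring
    using (solve; _:=_; _:+_; _:*_)
  open import Relation.Binary.Reasoning.PartialOrder poset

  XOR-balanced : Balanced XOR
  XOR-balanced = trans
    (∑₂-cong (cube 1) (cube 1) {λ a b → ⟦ XOR a b ⟧} {λ a b → ⟦ Vec.head a ⟧ * ⟦ Vec.head b ⟧} (λ { (a ∷ []) (b ∷ []) → ⟦⟧-* a b }))
    (trans (∑₂-product (cube 1) (cube 1) (⟦_⟧ ∘ Vec.head) (⟦_⟧ ∘ Vec.head)) (trans (*-congʳ ∑-signs) (zeroˡ _)))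

  moment : ∀ {m₁ m₂} → Gadget m₁ m₂ → Subset m₁ → Subset m₂ → Carrier
  moment {m₁} {m₂} g S T = ∑₂ (cube m₁) (cube m₂) (λ u v → ⟦ g u v ⟧ * ⟦ χ S u ⟧ * ⟦ χ T v ⟧)

  gadgetFourier≈moment : ∀ {m₁ m₂} (g : Gadget m₁ m₂) S T →
    gadgetFourier g S T ≈ moment g S T * (2# ^ (m₁ ℕ.+ m₂)) ⁻¹
  gadgetFourier≈moment {m₁} {m₂} g S T =
    *-cong (∑-cartesianProduct (cube m₁) (cube m₂) _) (⁻¹-cong (length-cubes m₁ m₂))

  moment≈gadgetFourier : ∀ {m₁ m₂} (g : Gadget m₁ m₂) S T →
    moment g S T ≈ 2# ^ (m₁ ℕ.+ m₂) * gadgetFourier g S T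
  moment≈gadgetFourier {m₁} {m₂} g S T = begin-equality
    moment g S T               ≈⟨ *-identityʳ _ ⟨
    moment g S T * 1#          ≈⟨ *-congˡ (*-inverseˡ (2^≉0 (m₁ ℕ.+ m₂))) ⟨
    moment g S T * (K ⁻¹ * K)  ≈⟨ *-assoc _ _ _ ⟨
    moment g S T * K ⁻¹ * K    ≈⟨ *-congʳ (gadgetFourier≈moment g S T) ⟨
    gadgetFourier g S T * K    ≈⟨ *-comm _ _ ⟩
    K * gadgetFourier g S T    ∎
    where K = 2# ^ (m₁ ℕ.+ m₂)

  gadgetFourier≈0⇒moment≈0 : ∀ {m₁ m₂} (g : Gadget m₁ m₂) S T →
    gadgetFourier g S T ≈ 0# → moment g S T ≈ 0#
  gadgetFourier≈0⇒moment≈0 g S T ĝ≈0 =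
    trans (moment≈gadgetFourier g S T) (trans (*-congˡ ĝ≈0) (zeroʳ _))

  -- h s t is the average over a, b = ±1 of (1 + s a) (1 + t b) h a b.
  ∑₂-interpolate : ∀ {A B : Set} (as : List A) (bs : List B) (s : A → Sign) (t : B → Sign)
    (h : Sign → Sign → Carrier) (w : A → B → Carrier) →
    ∑₂ as bs (λ u v → w u v * ⟦ s u ⟧) ≈ 0# →
    ∑₂ as bs (λ u v → w u v * ⟦ t v ⟧) ≈ 0# →
    2# ^ 2 * ∑₂ as bs (λ u v → h (s u) (t v) * w u v) ≈
    ∑₂ signs signs (λ a b → h a b *
      (∑₂ as bs w + ⟦ a ⟧ * ⟦ b ⟧ * ∑₂ as bs (λ u v → w u v * ⟦ s u ⟧ * ⟦ t v ⟧)))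
  ∑₂-interpolate as bs s t h w ws≈0 wt≈0 = begin-equality
    2# ^ 2 * ∑₂ as bs (λ u v → h (s u) (t v) * w u v)
      ≈⟨ ∑₂-*ˡ as bs (2# ^ 2) _ ⟨
    ∑₂ as bs (λ u v → 2# ^ 2 * (h (s u) (t v) * w u v))
      ≈⟨ ∑₂-cong as bs expand ⟩
    ∑₂ as bs (λ u v → ∑₂ signs signs (λ a b → h a b * kernel a b u v))
      ≈⟨ ∑₂-swap as bs signs signs (λ u v a b → h a b * kernel a b u v) ⟩
    ∑₂ signs signs (λ a b → ∑₂ as bs (λ u v → h a b * kernel a b u v))
      ≈⟨ ∑₂-cong signs signs (λ a b → trans (∑₂-*ˡ as bs (h a b) _) (*-congˡ (∑₂-kernel a b))) ⟩
    ∑₂ signs signs (λ a b → h a b *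
      (∑₂ as bs w + ⟦ a ⟧ * ⟦ b ⟧ * ∑₂ as bs (λ u v → w u v * ⟦ s u ⟧ * ⟦ t v ⟧))) ∎
    where
    kernel : Sign → Sign → _ → _ → Carrier
    kernel a b u v = (1# + ⟦ s u ⟧ * ⟦ a ⟧) * (1# + ⟦ t v ⟧ * ⟦ b ⟧) * w u v

    expand : ∀ u v → 2# ^ 2 * (h (s u) (t v) * w u v) ≈ ∑₂ signs signs (λ a b → h a b * kernel a b u v)
    expand u v = begin-equality
      2# ^ 2 * (h (s u) (t v) * w u v)
        ≈⟨ *-congˡ (*-congʳ ∑₂-δ) ⟨
      2# ^ 2 * (∑₂ signs signs δ * w u v)
        ≈⟨ *-congˡ (∑₂-*ʳ signs signs (w u v) δ) ⟨
      2# ^ 2 * ∑₂ signs signs (λ a b → δ a b * w u v)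
        ≈⟨ ∑₂-*ˡ signs signs (2# ^ 2) (λ a b → δ a b * w u v) ⟨
      ∑₂ signs signs (λ a b → 2# ^ 2 * (δ a b * w u v))
        ≈⟨ ∑₂-cong signs signs (λ a b → begin-equality
             2# ^ 2 * (δ a b * w u v)
               ≈⟨ trans (*-congʳ (*-congˡ (*-identityʳ 2#)))
                    (solve 5 (λ z x y e f → (z :* z) :* (x :* (y :* e) :* f) := e :* (z :* x :* (z :* y) :* f)) refl
                      2# (𝟙 (does (s u Sign.≟ a))) (𝟙 (does (t v Sign.≟ b))) (h a b) (w u v)) ⟩
             h a b * (2# * 𝟙 (does (s u Sign.≟ a)) * (2# * 𝟙 (does (t v Sign.≟ b))) * w u v)
               ≈⟨ *-congˡ (*-congʳ (*-cong (2*𝟙-≟ (s u) a) (2*𝟙-≟ (t v) b))) ⟩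
             h a b * kernel a b u v ∎) ⟩
      ∑₂ signs signs (λ a b → h a b * kernel a b u v) ∎
      where
      δ : Sign → Sign → Carrier
      δ a b = 𝟙 (does (s u Sign.≟ a)) * (𝟙 (does (t v Sign.≟ b)) * h a b)

      ∑₂-δ : ∑₂ signs signs δ ≈ h (s u) (t v)
      ∑₂-δ = trans
        (∑-cong signs {h = λ a → 𝟙 (does (s u Sign.≟ a)) * h a (t v)} (λ a →
          trans (∑-*ˡ signs (𝟙 (does (s u Sign.≟ a))) (λ b → 𝟙 (does (t v Sign.≟ b)) * h a b))
                (*-congˡ (∑-𝟙-sign (t v) (h a)))))
        (∑-𝟙-sign (s u) (λ a → h a (t v)))

    ∑₂-kernel : ∀ a b → ∑₂ as bs (kernel a b) ≈
      ∑₂ as bs w + ⟦ a ⟧ * ⟦ b ⟧ * ∑₂ as bs (λ u v → w u v * ⟦ s u ⟧ * ⟦ t v ⟧)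
    ∑₂-kernel a b = begin-equality
      ∑₂ as bs (kernel a b)
        -- The expanded product has four terms; the two containing just one of the parities are
        -- grouped last, where the hypotheses make their sums vanish.
        ≈⟨ ∑₂-cong as bs (λ u v → trans
             (solve 6 (λ o x y z t e → (o :+ x :* y) :* (o :+ z :* t) :* e :=
                                       o :* o :* e :+ (y :* t) :* (e :* x :* z) :+ (o :* y :* (e :* x) :+ o :* t :* (e :* z)))
                    refl 1# ⟦ s u ⟧ ⟦ a ⟧ ⟦ t v ⟧ ⟦ b ⟧ (w u v))
             (+-cong (+-congʳ (trans (*-congʳ (*-identityˡ 1#)) (*-identityˡ _))) refl)) ⟩
      ∑₂ as bs (λ u v → w u v + ⟦ a ⟧ * ⟦ b ⟧ * (w u v * ⟦ s u ⟧ * ⟦ t v ⟧) + (1# * ⟦ a ⟧ * (w u v * ⟦ s u ⟧) + 1# * ⟦ b ⟧ * (w u v * ⟦ t v ⟧)))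
        ≈⟨ trans (∑₂-+ as bs _ _) (+-cong (∑₂-+ as bs _ _) (∑₂-+ as bs _ _)) ⟩
      (∑₂ as bs w + ∑₂ as bs (λ u v → ⟦ a ⟧ * ⟦ b ⟧ * (w u v * ⟦ s u ⟧ * ⟦ t v ⟧))) +
      (∑₂ as bs (λ u v → 1# * ⟦ a ⟧ * (w u v * ⟦ s u ⟧)) + ∑₂ as bs (λ u v → 1# * ⟦ b ⟧ * (w u v * ⟦ t v ⟧)))
        ≈⟨ +-cong (+-congˡ (∑₂-*ˡ as bs _ _)) (+-cong (vanish ws≈0) (vanish wt≈0)) ⟩
      (∑₂ as bs w + ⟦ a ⟧ * ⟦ b ⟧ * ∑₂ as bs (λ u v → w u v * ⟦ s u ⟧ * ⟦ t v ⟧)) + (0# + 0#)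
        ≈⟨ trans (+-congˡ (+-identityˡ 0#)) (+-identityʳ _) ⟩
      ∑₂ as bs w + ⟦ a ⟧ * ⟦ b ⟧ * ∑₂ as bs (λ u v → w u v * ⟦ s u ⟧ * ⟦ t v ⟧) ∎
      where
      vanish : ∀ {c f} → ∑₂ as bs f ≈ 0# → ∑₂ as bs (λ u v → c * f u v) ≈ 0#
      vanish {c} {f} f≈0 = trans (∑₂-*ˡ as bs c f) (trans (*-congˡ f≈0) (zeroʳ c))

  parities : ∀ {m n} → Subset m → Blocks n m → Blocks n 1
  parities S = Vec.map (λ u → χ S u ∷ [])

  module _ {m₁ m₂} (g : Gadget m₁ m₂)
    (vanishing : ∀ S T → S ≡ ⊥ ⊎ T ≡ ⊥ → gadgetFourier g S T ≈ 0#) where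

    private
      cs = cube m₁
      ds = cube m₂
      K  = 2# ^ (m₁ ℕ.+ m₂)

    -- A character on one side alone is a pair of characters with the empty set on the other side.
    -- This and its mirror image are the hypotheses of `∑₂-interpolate` when the weight is g.
    ∑₂-g*χS≈0 : ∀ S → ∑₂ cs ds (λ u v → ⟦ g u v ⟧ * ⟦ χ S u ⟧) ≈ 0#
    ∑₂-g*χS≈0 S = trans
      (∑₂-cong cs ds (λ u v → sym (trans (*-congˡ (reflexive (≡.cong ⟦_⟧ (χ-⊥ v)))) (*-identityʳ _))))
      (gadgetFourier≈0⇒moment≈0 g S ⊥ (vanishing S ⊥ (inj₂ ≡.refl)))

    ∑₂-g*χT≈0 : ∀ T → ∑₂ cs ds (λ u v → ⟦ g u v ⟧ * ⟦ χ T v ⟧) ≈ 0#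
    ∑₂-g*χT≈0 T = trans
      (∑₂-cong cs ds (λ u v → *-congʳ (sym (trans (*-congˡ (reflexive (≡.cong ⟦_⟧ (χ-⊥ u)))) (*-identityʳ _)))))
      (gadgetFourier≈0⇒moment≈0 g ⊥ T (vanishing ⊥ T (inj₁ ≡.refl)))

    balanced : Balanced g
    balanced = trans
      (∑₂-cong cs ds (λ u v → sym (trans (*-congˡ (reflexive (≡.cong ⟦_⟧ (χ-⊥ u)))) (*-identityʳ _))))
      (∑₂-g*χS≈0 ⊥)

    module _ {S T} (∑χS≈0 : ∑ cs (λ u → ⟦ χ S u ⟧) ≈ 0#) (∑χT≈0 : ∑ ds (λ v → ⟦ χ T v ⟧) ≈ 0#) where

      -- The case of a block outside I. With weight 1 every nonconstant term of the interpolation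
      -- sums to zero, so the pair of parities is uniform on the four sign pairs.
      ∑₂-outside : ∀ (h : Sign → Sign → Carrier) →
        2# ^ 2 * ∑₂ cs ds (λ u v → h (χ S u) (χ T v)) ≈ K * ∑₂ signs signs h
      ∑₂-outside h = begin-equality
        2# ^ 2 * ∑₂ cs ds (λ u v → h (χ S u) (χ T v))
          ≈⟨ *-congˡ (∑₂-cong cs ds (λ u v → sym (*-identityʳ _))) ⟩
        2# ^ 2 * ∑₂ cs ds (λ u v → h (χ S u) (χ T v) * 1#)
          ≈⟨ ∑₂-interpolate cs ds (χ S) (χ T) h (λ _ _ → 1#)
               (trans (∑₂-cong cs ds (λ u v → *-comm 1# _)) (trans (∑₂-product cs ds (λ u → ⟦ χ S u ⟧) (λ _ → 1#)) (trans (*-congʳ ∑χS≈0) (zeroˡ _))))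
               (trans (∑₂-product cs ds (λ _ → 1#) (λ v → ⟦ χ T v ⟧)) (trans (*-congˡ ∑χT≈0) (zeroʳ _))) ⟩
        ∑₂ signs signs (λ a b → h a b * (∑₂ cs ds (λ _ _ → 1#) + ⟦ a ⟧ * ⟦ b ⟧ * Σχχ))
          ≈⟨ ∑₂-cong signs signs simplify ⟩
        ∑₂ signs signs (λ a b → h a b * K)
          ≈⟨ trans (∑₂-*ʳ signs signs K h) (*-comm _ K) ⟩
        K * ∑₂ signs signs h ∎
        where
        Σχχ = ∑₂ cs ds (λ u v → 1# * ⟦ χ S u ⟧ * ⟦ χ T v ⟧)

        Σχχ≈0 : Σχχ ≈ 0#
        Σχχ≈0 = trans (∑₂-product cs ds (λ u → 1# * ⟦ χ S u ⟧) (λ v → ⟦ χ T v ⟧))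
                      (trans (*-congˡ ∑χT≈0) (zeroʳ _))

        simplify : ∀ a b → h a b * (∑₂ cs ds (λ _ _ → 1#) + ⟦ a ⟧ * ⟦ b ⟧ * Σχχ) ≈ h a b * K
        simplify a b = *-congˡ (trans
          (+-cong (∑-cubes m₁ m₂) (trans (*-congˡ Σχχ≈0) (zeroʳ _))) (+-identityʳ K))

      -- The case of a block in I. With weight g the constant term vanishes by balance and only the
      -- joint term survives: g acts on functions of the two parities as ĝ(S,T) times their XOR.
      ∑₂-inside : ∀ (h : Sign → Sign → Carrier) →
        2# ^ 2 * ∑₂ cs ds (λ u v → h (χ S u) (χ T v) * ⟦ g u v ⟧) ≈
        K * gadgetFourier g S T * ∑₂ signs signs (λ a b → h a b * ⟦ a Sign.* b ⟧)
      ∑₂-inside h = begin-equality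
        2# ^ 2 * ∑₂ cs ds (λ u v → h (χ S u) (χ T v) * ⟦ g u v ⟧)
          ≈⟨ ∑₂-interpolate cs ds (χ S) (χ T) h (λ u v → ⟦ g u v ⟧) (∑₂-g*χS≈0 S) (∑₂-g*χT≈0 T) ⟩
        ∑₂ signs signs (λ a b → h a b * (∑₂ cs ds (λ u v → ⟦ g u v ⟧) + ⟦ a ⟧ * ⟦ b ⟧ * moment g S T))
          ≈⟨ ∑₂-cong signs signs simplify ⟩
        ∑₂ signs signs (λ a b → h a b * ⟦ a Sign.* b ⟧ * (K * gadgetFourier g S T))
          ≈⟨ trans (∑₂-*ʳ signs signs _ (λ a b → h a b * ⟦ a Sign.* b ⟧)) (*-comm _ _) ⟩
        K * gadgetFourier g S T * ∑₂ signs signs (λ a b → h a b * ⟦ a Sign.* b ⟧) ∎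
        where
        simplify : ∀ a b →
          h a b * (∑₂ cs ds (λ u v → ⟦ g u v ⟧) + ⟦ a ⟧ * ⟦ b ⟧ * moment g S T) ≈
          h a b * ⟦ a Sign.* b ⟧ * (K * gadgetFourier g S T)
        simplify a b = trans
          (*-congˡ (trans (+-congʳ balanced) (trans (+-identityˡ _)
            (*-cong (sym (⟦⟧-* a b)) (moment≈gadgetFourier g S T)))))
          (sym (*-assoc _ _ _))

      -- Induction on the blocks, with `∑₂-inside` or `∑₂-outside` for the first one. F is arbitrary
      -- because fixing the first parities changes it. The powers of 4 and K count the inputs of XOR
      -- and of g, multiplied across instead of divided.
      correlation-parities : ∀ {n} (F : Blocks n 1 → Blocks n 1 → Carrier) (I : Subset n) →
        (2# ^ 2) ^ n * correlation g (λ x y → F (parities S x) (parities T y)) I ≈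
        K ^ n * gadgetFourier g S T ^ ∣ I ∣ * correlation XOR F I
      correlation-parities F [] = *-congʳ (sym (*-identityʳ 1#))
      correlation-parities {ℕ.suc n} F (i ∷ I) = begin-equality
        4# * 4# ^ n * correlation g (λ x y → F (parities S x) (parities T y)) (i ∷ I)
          ≈⟨ *-congˡ (∑₂-vectors cs ds n _) ⟩
        4# * 4# ^ n * ∑₂ cs ds (λ u v → ∑₂ (blocks n m₁) (blocks n m₂) (λ x y →
          rest (χ S u) (χ T v) (parities S x) (parities T y) * ⟦ χ (i ∷ I) (g u v ∷ zipWith g x y) ⟧))
          ≈⟨ *-congˡ (∑₂-cong cs ds (λ u v → pull (blocks n m₁) (blocks n m₂) i (g u v) _ (zipWith g))) ⟩
        4# * 4# ^ n * ∑₂ cs ds (λ u v → H (χ S u) (χ T v) * factor i (g u v))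
          -- The factor `4# ^ n` moves under the sum over (u , v) so that the induction hypothesis
          -- applies for each pair, to F with its first parities fixed.
          ≈⟨ trans (*-assoc _ _ _) (*-congˡ (trans (sym (∑₂-*ˡ cs ds (4# ^ n) _)) (∑₂-cong cs ds (λ u v →
               trans (sym (*-assoc _ _ _)) (*-congʳ (correlation-parities (rest (χ S u) (χ T v)) I)))))) ⟩
        4# * ∑₂ cs ds (λ u v → K ^ n * ĝ ^ ∣ I ∣ * H′ (χ S u) (χ T v) * factor i (g u v))
          ≈⟨ *-congˡ (trans (∑₂-cong cs ds (λ u v → *-assoc _ _ _)) (∑₂-*ˡ cs ds _ _)) ⟩
        4# * (K ^ n * ĝ ^ ∣ I ∣ * ∑₂ cs ds (λ u v → H′ (χ S u) (χ T v) * factor i (g u v)))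
          ≈⟨ trans (sym (*-assoc _ _ _)) (trans (*-congʳ (*-comm _ _)) (*-assoc _ _ _)) ⟩
        K ^ n * ĝ ^ ∣ I ∣ * (4# * ∑₂ cs ds (λ u v → H′ (χ S u) (χ T v) * factor i (g u v)))
          ≈⟨ *-congˡ (block i) ⟩
        K ^ n * ĝ ^ ∣ I ∣ * (K * ĝ ^ ∣ i ∷ [] ∣ * ∑₂ signs signs (λ a b → H′ a b * factor i (a Sign.* b)))
          ≈⟨ trans (sym (*-assoc _ _ _)) (*-congʳ (power i)) ⟩
        K ^ ℕ.suc n * ĝ ^ ∣ i ∷ I ∣ * ∑₂ signs signs (λ a b → H′ a b * factor i (a Sign.* b))
          -- A sum over `cube 1` unfolds to the sum over `signs` with `a ∷ []` in place of `a`.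
          ≈⟨ *-congˡ (∑₂-cong signs signs (λ a b → sym (pull (blocks n 1) (blocks n 1) i (a Sign.* b) (rest a b) (zipWith XOR)))) ⟩
        K ^ ℕ.suc n * ĝ ^ ∣ i ∷ I ∣ * ∑₂ (cube 1) (cube 1) (λ a b → ∑₂ (blocks n 1) (blocks n 1) (λ x y →
          F (a ∷ x) (b ∷ y) * ⟦ χ (i ∷ I) (XOR a b ∷ zipWith XOR x y) ⟧))
          ≈⟨ *-congˡ (∑₂-vectors (cube 1) (cube 1) n _) ⟨
        K ^ ℕ.suc n * ĝ ^ ∣ i ∷ I ∣ * correlation XOR F (i ∷ I) ∎
        where
        4# = 2# ^ 2
        ĝ = gadgetFourier g S T

        rest : Sign → Sign → Blocks n 1 → Blocks n 1 → Carrier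
        rest a b x y = F ((a ∷ []) ∷ x) ((b ∷ []) ∷ y)

        H H′ : Sign → Sign → Carrier
        H a b = correlation g (λ x y → rest a b (parities S x) (parities T y)) I
        H′ a b = correlation XOR (rest a b) I

        factor : Bool → Sign → Carrier
        factor inside  s = ⟦ s ⟧
        factor outside s = 1#

        pull : ∀ {A B : Set} (as : List A) (bs : List B) i s (f : A → B → Carrier) (z : A → B → Cube n) →
          ∑₂ as bs (λ x y → f x y * ⟦ χ (i ∷ I) (s ∷ z x y) ⟧) ≈
          ∑₂ as bs (λ x y → f x y * ⟦ χ I (z x y) ⟧) * factor i s
        pull as bs outside s f z = sym (*-identityʳ _)
        pull as bs inside  s f z = trans
          (∑₂-cong as bs (λ x y → trans (*-congˡ (trans (⟦⟧-* s (χ I (z x y))) (*-comm _ _))) (sym (*-assoc _ _ _))))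
          (∑₂-*ʳ as bs ⟦ s ⟧ _)

        block : ∀ i → 4# * ∑₂ cs ds (λ u v → H′ (χ S u) (χ T v) * factor i (g u v)) ≈
                K * ĝ ^ ∣ i ∷ [] ∣ * ∑₂ signs signs (λ a b → H′ a b * factor i (a Sign.* b))
        block inside  = trans (∑₂-inside H′) (*-congʳ (*-congˡ (sym (*-identityʳ ĝ))))
        block outside = trans (∑₂-outside (λ a b → H′ a b * 1#)) (*-congʳ (sym (*-identityʳ K)))

        power : ∀ i → K ^ n * ĝ ^ ∣ I ∣ * (K * ĝ ^ ∣ i ∷ [] ∣) ≈ K ^ ℕ.suc n * ĝ ^ ∣ i ∷ I ∣
        power inside  = trans (*-congˡ (*-congˡ (*-identityʳ ĝ)))
          (solve 4 (λ w x y z → w :* x :* (y :* z) := y :* w :* (z :* x)) refl (K ^ n) (ĝ ^ ∣ I ∣) K ĝ)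
        power outside = trans (*-congˡ (*-identityʳ K))
          (solve 3 (λ w x y → w :* x :* y := y :* w :* x) refl (K ^ n) (ĝ ^ ∣ I ∣) K)

      -- The factors in `correlation-parities` are exactly the totals by which `fourier-gFiber`
      -- divides, for XOR and for g, so they cancel.
      fourier-parities : ∀ {n} (F : Blocks n 1 → Blocks n 1 → Carrier) (I : Subset n) →
        fourier (gFiber g (λ x y → F (parities S x) (parities T y))) I ≈
        gadgetFourier g S T ^ ∣ I ∣ * fourier (gFiber XOR F) I
      fourier-parities {n} F I = begin-equality
        fourier (gFiber g F′) I
          ≈⟨ fourier-gFiber g balanced F′ I ⟩
        correlation g F′ I * (K ^ n) ⁻¹
          ≈⟨ *-congʳ (trans (*-congʳ (*-inverseˡ (total≉0 XOR XOR-balanced n))) (*-identityˡ _)) ⟨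
        X ⁻¹ * X * correlation g F′ I * (K ^ n) ⁻¹
          ≈⟨ *-congʳ (trans (*-assoc _ _ _) (*-congˡ (correlation-parities F I))) ⟩
        X ⁻¹ * (K ^ n * ĝ^ * correlation XOR F I) * (K ^ n) ⁻¹
          ≈⟨ solve 5 (λ x k e c l → x :* (k :* e :* c) :* l := k :* l :* (e :* (c :* x))) refl (X ⁻¹) (K ^ n) ĝ^ (correlation XOR F I) ((K ^ n) ⁻¹) ⟩
        K ^ n * (K ^ n) ⁻¹ * (ĝ^ * (correlation XOR F I * X ⁻¹))
          ≈⟨ trans (*-congʳ (*-inverseʳ (total≉0 g balanced n))) (*-identityˡ _) ⟩
        ĝ^ * (correlation XOR F I * X ⁻¹)
          ≈⟨ *-congˡ (fourier-gFiber XOR XOR-balanced F I) ⟨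
        ĝ^ * fourier (gFiber XOR F) I ∎
        where
        F′ = λ x y → F (parities S x) (parities T y)
        X = (2# ^ 2) ^ n
        ĝ^ = gadgetFourier g S T ^ ∣ I ∣

-- Parseval's identity and the largest coefficient

module LargestCoefficient (ℝ : Reals) where
  open Reals ℝ
  open Analysis ℝ
  open OrderedField ℝ
  open Sums ℝ
  open Fibers ℝ
  open Lifting ℝ
  open TotalOrder totalOrder using (poset)
    renaming (trans to ≤-trans)
  open import Algebra.Properties.Ring ring
  open import Algebra.Properties.CommutativeSemiring.Exp commutativeSemiring
    using (^-homo-*; ^-assocʳ; ^-distrib-*)
  open import Algebra.Solver.Ring.NaturalCoefficients.Default commutativeSemiring
    using (solve; _:=_; _:+_; _:*_)
  open import Relation.Binary.Reasoning.PartialOrder poset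

  parallelogram : ∀ p q → (p + q) * (p + q) + (p + - q) * (p + - q) ≈ 2# * (p * p + q * q)
  parallelogram p q = begin-equality
    (p + q) * (p + q) + (p + - q) * (p + - q)
      ≈⟨ solve 3 (λ p q r → (p :+ q) :* (p :+ q) :+ (p :+ r) :* (p :+ r) :=
                            (p :* p :+ q :* q) :+ (p :* p :+ r :* r) :+ (p :+ p) :* (q :+ r)) refl p q (- q) ⟩
    (p * p + q * q) + (p * p + - q * - q) + (p + p) * (q + - q)
      ≈⟨ +-cong (+-congˡ (+-congˡ (-x*-y≈x*y q q))) (trans (*-congˡ (-‿inverseʳ q)) (zeroʳ _)) ⟩
    (p * p + q * q) + (p * p + q * q) + 0#
      ≈⟨ +-identityʳ _ ⟩
    (p * p + q * q) + (p * p + q * q)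
      ≈⟨ +-cong (*-identityˡ _) (*-identityˡ _) ⟨
    1# * (p * p + q * q) + 1# * (p * p + q * q)
      ≈⟨ distribʳ _ 1# 1# ⟨
    2# * (p * p + q * q) ∎

  -- Splitting off the first coordinate, the coefficients without and with it are the sum and the
  -- difference of those of the two halves of f, so the parallelogram law gives the factor 2 of the
  -- induction step.
  parseval : ∀ m (f : Cube m → Carrier) →
    ∑ (subsets m) (λ S → ∑ (cube m) (λ x → f x * ⟦ χ S x ⟧) * ∑ (cube m) (λ x → f x * ⟦ χ S x ⟧)) ≈
    2# ^ m * ∑ (cube m) (λ x → f x * f x)
  parseval ℕ.zero f = trans
    (+-congʳ (*-cong f1≈f f1≈f))
    (sym (*-identityˡ _))
    where
    f1≈f : f [] * 1# + 0# ≈ f []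
    f1≈f = trans (+-identityʳ _) (*-identityʳ _)
  parseval (ℕ.suc m) f = begin-equality
    ∑ (subsets (ℕ.suc m)) (λ S → coef S * coef S)
      ≈⟨ ∑-vectors (outside ∷ inside ∷ []) m (λ S → coef S * coef S) ⟩
    ∑ (subsets m) (λ S → coef (outside ∷ S) * coef (outside ∷ S)) +
    (∑ (subsets m) (λ S → coef (inside ∷ S) * coef (inside ∷ S)) + 0#)
      ≈⟨ +-congˡ (+-identityʳ _) ⟩
    ∑ (subsets m) (λ S → coef (outside ∷ S) * coef (outside ∷ S)) +
    ∑ (subsets m) (λ S → coef (inside ∷ S) * coef (inside ∷ S))
      ≈⟨ ∑-+ (subsets m) _ _ ⟨
    ∑ (subsets m) (λ S → coef (outside ∷ S) * coef (outside ∷ S) + coef (inside ∷ S) * coef (inside ∷ S))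
      ≈⟨ ∑-cong (subsets m) (λ S → trans
           (+-cong (*-cong (coef-outside S) (coef-outside S)) (*-cong (coef-inside S) (coef-inside S)))
           (parallelogram (half Sign.+ S) (half Sign.- S))) ⟩
    ∑ (subsets m) (λ S → 2# * (half Sign.+ S * half Sign.+ S + half Sign.- S * half Sign.- S))
      ≈⟨ trans (∑-*ˡ (subsets m) 2# _) (*-congˡ (∑-+ (subsets m) _ _)) ⟩
    2# * (∑ (subsets m) (λ S → half Sign.+ S * half Sign.+ S) + ∑ (subsets m) (λ S → half Sign.- S * half Sign.- S))
      ≈⟨ *-congˡ (+-cong (parseval m _) (parseval m _)) ⟩
    2# * (2# ^ m * energy Sign.+ + 2# ^ m * energy Sign.-)
      ≈⟨ trans (*-congˡ (sym (distribˡ _ _ _))) (sym (*-assoc _ _ _)) ⟩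
    2# * 2# ^ m * (energy Sign.+ + energy Sign.-)
      ≈⟨ *-congˡ (+-congˡ (+-identityʳ _)) ⟨
    2# ^ ℕ.suc m * ∑ signs energy
      ≈⟨ *-congˡ (∑-vectors signs m (λ x → f x * f x)) ⟨
    2# ^ ℕ.suc m * ∑ (cube (ℕ.suc m)) (λ x → f x * f x) ∎
    where
    coef : Subset (ℕ.suc m) → Carrier
    coef S = ∑ (cube (ℕ.suc m)) (λ x → f x * ⟦ χ S x ⟧)

    half : Sign → Subset m → Carrier
    half a S = ∑ (cube m) (λ x → f (a ∷ x) * ⟦ χ S x ⟧)

    energy : Sign → Carrier
    energy a = ∑ (cube m) (λ x → f (a ∷ x) * f (a ∷ x))

    coef-outside : ∀ S → coef (outside ∷ S) ≈ half Sign.+ S + half Sign.- S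
    coef-outside S = trans (∑-vectors signs m (λ x → f x * ⟦ χ (outside ∷ S) x ⟧)) (+-congˡ (+-identityʳ _))

    coef-inside : ∀ S → coef (inside ∷ S) ≈ half Sign.+ S + - half Sign.- S
    coef-inside S = trans (∑-vectors signs m (λ x → f x * ⟦ χ (inside ∷ S) x ⟧))
      (+-congˡ (trans (+-identityʳ _) (begin-equality
        ∑ (cube m) (λ x → f (Sign.- ∷ x) * ⟦ Sign.- Sign.* χ S x ⟧)
          ≈⟨ ∑-cong (cube m) (λ x → trans (*-congˡ (trans (⟦⟧-* Sign.- (χ S x)) (*-comm _ _))) (trans (sym (*-assoc _ _ _)) (*-comm _ _))) ⟩
        ∑ (cube m) (λ x → - 1# * (f (Sign.- ∷ x) * ⟦ χ S x ⟧))
          ≈⟨ ∑-*ˡ (cube m) (- 1#) _ ⟩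
        - 1# * half Sign.- S
          ≈⟨ -1*x≈-x _ ⟩
        - half Sign.- S ∎)))

  module _ {m₁ m₂} (g : Gadget m₁ m₂) where

    private
      cs = cube m₁
      ds = cube m₂
      Ss = subsets m₁
      Ts = subsets m₂
      K  = 2# ^ (m₁ ℕ.+ m₂)
      M  = maxFourier g

      ∣ĝ∣ : Subset m₁ × Subset m₂ → Carrier
      ∣ĝ∣ (S , T) = ∣ gadgetFourier g S T ∣ᵣ

    -- Parseval is applied in Alice's variable with T fixed, then in Bob's with u fixed. Together
    -- they give one factor K; the other is the sum of g² = 1 over all inputs.
    ∑₂-moment² : ∑₂ Ss Ts (λ S T → moment g S T * moment g S T) ≈ K * K
    ∑₂-moment² = begin-equality
      ∑₂ Ss Ts (λ S T → moment g S T * moment g S T)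
        ≈⟨ ∑-swap Ss Ts _ ⟩
      ∑ Ts (λ T → ∑ Ss (λ S → moment g S T * moment g S T))
        ≈⟨ ∑-cong Ts (λ T → ∑-cong Ss (λ S → *-cong (moment-row S T) (moment-row S T))) ⟩
      ∑ Ts (λ T → ∑ Ss (λ S → ∑ cs (λ u → row T u * ⟦ χ S u ⟧) * ∑ cs (λ u → row T u * ⟦ χ S u ⟧)))
        ≈⟨ ∑-cong Ts (λ T → parseval m₁ (row T)) ⟩
      ∑ Ts (λ T → 2# ^ m₁ * ∑ cs (λ u → row T u * row T u))
        ≈⟨ trans (∑-*ˡ Ts _ _) (*-congˡ (∑-swap Ts cs _)) ⟩
      2# ^ m₁ * ∑ cs (λ u → ∑ Ts (λ T → row T u * row T u))
        ≈⟨ *-congˡ (∑-cong cs (λ u → parseval m₂ (λ v → ⟦ g u v ⟧))) ⟩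
      2# ^ m₁ * ∑ cs (λ u → 2# ^ m₂ * ∑ ds (λ v → ⟦ g u v ⟧ * ⟦ g u v ⟧))
        ≈⟨ trans (*-congˡ (∑-*ˡ cs _ _)) (sym (*-assoc _ _ _)) ⟩
      2# ^ m₁ * 2# ^ m₂ * ∑₂ cs ds (λ u v → ⟦ g u v ⟧ * ⟦ g u v ⟧)
        ≈⟨ *-cong (sym (^-homo-* 2# m₁ m₂)) (trans (∑₂-cong cs ds (λ u v → ⟦⟧²≈1 (g u v))) (∑-cubes m₁ m₂)) ⟩
      K * K ∎
      where
      row : Subset m₂ → Cube m₁ → Carrier
      row T u = ∑ ds (λ v → ⟦ g u v ⟧ * ⟦ χ T v ⟧)

      moment-row : ∀ S T → moment g S T ≈ ∑ cs (λ u → row T u * ⟦ χ S u ⟧)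
      moment-row S T = ∑-cong cs (λ u → trans
        (∑-cong ds (λ v → solve 3 (λ x y z → x :* y :* z := x :* z :* y) refl ⟦ g u v ⟧ ⟦ χ S u ⟧ ⟦ χ T v ⟧))
        (∑-*ʳ ds ⟦ χ S u ⟧ _))

    0≤M : 0# ≤ M
    0≤M = Extrema.⊥≤max totalOrder 0# (map ∣ĝ∣ (cartesianProduct Ss Ts))

    -- K occurs in two roles: each moment is K times a coefficient, and there are K pairs (S , T),
    -- each with squared coefficient at most M². The common factor K² is cancelled.
    1≤K*M² : 1# ≤ K * (M * M)
    1≤K*M² = *-cancelˡ-≤ K*K≉0 (*-nonNeg 0≤K 0≤K) (begin
      K * K * 1#
        ≈⟨ *-identityʳ _ ⟩
      K * K
        ≈⟨ ∑₂-moment² ⟨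
      ∑₂ Ss Ts (λ S T → moment g S T * moment g S T)
        ≈⟨ ∑₂-cong Ss Ts (λ S T → trans
             (*-cong (moment≈gadgetFourier g S T) (moment≈gadgetFourier g S T))
             (trans (solve 2 (λ k x → k :* x :* (k :* x) := k :* k :* (x :* x)) refl K (gadgetFourier g S T))
                    (*-congˡ (sym (∣x∣²≈x² _))))) ⟩
      ∑₂ Ss Ts (λ S T → K * K * (∣ĝ∣ (S , T) * ∣ĝ∣ (S , T)))
        ≈⟨ trans (∑₂-*ˡ Ss Ts (K * K) _) (*-congˡ (sym (∑-cartesianProduct Ss Ts _))) ⟩
      K * K * ∑ (cartesianProduct Ss Ts) (λ p → ∣ĝ∣ p * ∣ĝ∣ p)
        ≤⟨ *-monoˡ-≤ (*-nonNeg 0≤K 0≤K) (∑-mono (cartesianProduct Ss Ts) squares) ⟩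
      K * K * ∑ (cartesianProduct Ss Ts) (λ _ → M * M)
        ≈⟨ *-congˡ (trans (∑-const (cartesianProduct Ss Ts) (M * M)) (*-comm _ _)) ⟩
      K * K * (∑ (cartesianProduct Ss Ts) (λ _ → 1#) * (M * M))
        ≈⟨ *-congˡ (*-congʳ (trans (∑-cartesianProduct Ss Ts _) (∑-pairs-1 outside inside outside inside m₁ m₂))) ⟩
      K * K * (K * (M * M)) ∎)
      where
      0≤K : 0# ≤ K
      0≤K = ^-nonNeg (m₁ ℕ.+ m₂) (≤-trans 0≤1 1≤2)

      K*K≉0 : ¬ (K * K ≈ 0#)
      K*K≉0 K²≈0 = 2^≉0 ((m₁ ℕ.+ m₂) ℕ.+ (m₁ ℕ.+ m₂)) (trans (^-homo-* 2# (m₁ ℕ.+ m₂) (m₁ ℕ.+ m₂)) K²≈0)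

      squares : All (λ p → ∣ĝ∣ p * ∣ĝ∣ p ≤ M * M) (cartesianProduct Ss Ts)
      squares = All.map (λ {p} ∣ĝ∣≤M → *-mono-≤ (∣x∣-nonNeg (gadgetFourier g (proj₁ p) (proj₂ p))) 0≤M ∣ĝ∣≤M ∣ĝ∣≤M)
        (All.map⁻ {P = _≤ M} {f = ∣ĝ∣} (Extrema.xs≤max totalOrder 0# (map ∣ĝ∣ (cartesianProduct Ss Ts))))

    M≉0 : ¬ (M ≈ 0#)
    M≉0 M≈0 = 1≤⇒≉0 1≤K*M² (trans (*-congˡ (trans (*-congˡ M≈0) (zeroʳ M))) (zeroʳ K))

    0≤M⁻¹ : 0# ≤ M ⁻¹
    0≤M⁻¹ = ⁻¹-nonNeg M≉0 0≤M

    M⁻¹*M⁻¹≤K : M ⁻¹ * M ⁻¹ ≤ K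
    M⁻¹*M⁻¹≤K = begin
      M ⁻¹ * M ⁻¹                      ≈⟨ *-identityʳ _ ⟨
      M ⁻¹ * M ⁻¹ * 1#                 ≤⟨ *-monoˡ-≤ (*-nonNeg 0≤M⁻¹ 0≤M⁻¹) 1≤K*M² ⟩
      M ⁻¹ * M ⁻¹ * (K * (M * M))      ≈⟨ solve 3 (λ i k m → i :* i :* (k :* (m :* m)) := k :* ((m :* i) :* (m :* i))) refl (M ⁻¹) K M ⟩
      K * ((M * M ⁻¹) * (M * M ⁻¹))    ≈⟨ *-congˡ (trans (*-cong (*-inverseʳ M≉0) (*-inverseʳ M≉0)) (*-identityˡ 1#)) ⟩
      K * 1#                           ≈⟨ *-identityʳ K ⟩
      K                                ∎

    -- The possibly half-integral exponent is expressed by a root, so the comparison is made after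
    -- squaring.
    M⁻¹^k≤√ : ∀ k → (M ⁻¹) ^ k ≤ √ (2# ^ ((m₁ ℕ.+ m₂) ℕ.* k))
    M⁻¹^k≤√ k = y≤√x (^-nonNeg ((m₁ ℕ.+ m₂) ℕ.* k) (≤-trans 0≤1 1≤2)) (begin
      (M ⁻¹) ^ k * (M ⁻¹) ^ k        ≈⟨ ^-distrib-* (M ⁻¹) (M ⁻¹) k ⟨
      (M ⁻¹ * M ⁻¹) ^ k              ≤⟨ ^-monoˡ-≤ k (*-nonNeg 0≤M⁻¹ 0≤M⁻¹) M⁻¹*M⁻¹≤K ⟩
      K ^ k                          ≈⟨ ^-assocʳ 2# (m₁ ℕ.+ m₂) k ⟩
      2# ^ ((m₁ ℕ.+ m₂) ℕ.* k)       ∎)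

    M-attained : ∃₂ λ S T → M ≈ ∣ gadgetFourier g S T ∣ᵣ
    M-attained with Extrema.argmax-sel totalOrder id 0# (map ∣ĝ∣ (cartesianProduct Ss Ts))
    -- The maximum could a priori be its starting value 0 rather than an entry of the list.
    ... | inj₁ M≡0 = contradiction (reflexive M≡0) M≉0
    ... | inj₂ M∈  with ∈-map⁻ ∣ĝ∣ M∈
    ...   | (S , T) , _ , M≡ = S , T , reflexive M≡

-- Randomized protocols and their suprema

module Randomized (ℝ : Reals) where
  open Reals ℝ
  open Analysis ℝ
  open OrderedField ℝ
  open Sums ℝ
  open Fibers ℝ
  open Lifting ℝ
  open LargestCoefficient ℝ
  open TotalOrder totalOrder using (poset)
    renaming (refl to ≤-refl; reflexive to ≤-reflexive; trans to ≤-trans)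
  open import Algebra.Properties.Semiring.Sum semiring using (sum-cong-≋)
  open import Algebra.Properties.CommutativeSemiring.Exp commutativeSemiring
    using (^-congˡ; ^-distrib-*)
  open import Relation.Binary.Reasoning.PartialOrder poset

  private variable
    X Y X′ Y′ : Set
    d : ℕ

  -- Each player transforms their own input locally, so no communication is added and the index d is
  -- unchanged.
  comap : (X′ → X) → (Y′ → Y) → Protocol X Y d → Protocol X′ Y′ d
  comap α β (output s)    = output s
  comap α β (alice bit p) = alice (bit ∘ α) (comap α β ∘ p)
  comap α β (bob bit p)   = bob (bit ∘ β) (comap α β ∘ p)

  run-comap : ∀ (α : X′ → X) (β : Y′ → Y) (p : Protocol X Y d) x y →
              run (comap α β p) x y ≡ run p (α x) (β y)
  run-comap α β (output s)    x y = ≡.refl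
  run-comap α β (alice bit p) x y = run-comap α β (p (bit (α x))) x y
  run-comap α β (bob bit p)   x y = run-comap α β (p (bit (β y))) x y

  comapᵣ : (X′ → X) → (Y′ → Y) → RandomizedProtocol X Y d → RandomizedProtocol X′ Y′ d
  comapᵣ α β C = record
    { size          = size
    ; weight        = weight
    ; weight-nonNeg = weight-nonNeg
    ; weight-total  = weight-total
    ; protocol      = comap α β ∘ protocol
    } where open RandomizedProtocol C

  value-comapᵣ : ∀ (α : X′ → X) (β : Y′ → Y) (C : RandomizedProtocol X Y d) x y →
                 value (comapᵣ α β C) x y ≈ value C (α x) (β y)
  value-comapᵣ α β C x y = sum-cong-≋ (λ ω → *-congˡ (reflexive (≡.cong ⟦_⟧ (run-comap α β (protocol ω) x y))))
    where open RandomizedProtocol C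

  -- A witness that the sets under the suprema are inhabited, at every cost d.
  constant : RandomizedProtocol X Y d
  constant = record
    { size          = 1
    ; weight        = λ _ → 1#
    ; weight-nonNeg = λ _ → 0≤1
    ; weight-total  = +-identityʳ 1#
    ; protocol      = λ _ → output Sign.+
    }

  ∣∑Fin∣≤∑Fin : ∀ {n} (f w : Fin n → Carrier) → (∀ ω → ∣ f ω ∣ᵣ ≤ w ω) → ∣ ∑Fin f ∣ᵣ ≤ ∑Fin w
  ∣∑Fin∣≤∑Fin {ℕ.zero}  f w ∣f∣≤w = ≤-reflexive (0≤x⇒∣x∣≈x ≤-refl)
  ∣∑Fin∣≤∑Fin {ℕ.suc n} f w ∣f∣≤w = ≤-trans (∣x+y∣≤∣x∣+∣y∣ (f Fin.zero) _)
    (+-mono-≤ (∣f∣≤w Fin.zero) (∣∑Fin∣≤∑Fin (f ∘ Fin.suc) (w ∘ Fin.suc) (∣f∣≤w ∘ Fin.suc)))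

  ∣value∣≤1 : ∀ (C : RandomizedProtocol X Y d) x y → ∣ value C x y ∣ᵣ ≤ 1#
  ∣value∣≤1 C x y = ≤-trans
    (∣∑Fin∣≤∑Fin _ weight (λ ω → ≤-reflexive (trans (∣∣-* (weight ω) _)
      (trans (*-cong (0≤x⇒∣x∣≈x (weight-nonNeg ω)) (∣⟦⟧∣≈1 (run (protocol ω) x y))) (*-identityʳ _)))))
    (≤-reflexive weight-total)
    where open RandomizedProtocol C

  L₁-nonNeg : ∀ {n} k (f : Cube n → Carrier) → 0# ≤ L₁ k f
  L₁-nonNeg {n} k f = ∑-nonNeg (filter (λ I → ∣ I ∣ ℕ.≟ k) (subsets n)) (λ I → ∣x∣-nonNeg (fourier f I))

  module _ {m₁ m₂} (g : Gadget m₁ m₂)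
    (vanishing : ∀ S T → S ≡ ⊥ ⊎ T ≡ ⊥ → gadgetFourier g S T ≈ 0#)
    (k d n : ℕ) where

    private
      xs = blocks n m₁
      ys = blocks n m₂
      M  = maxFourier g
      levelₖ = filter (λ I → ∣ I ∣ ℕ.≟ k) (subsets n)

    -- Crude, but `sup-upper` asks only for some bound: values and characters have absolute value at
    -- most 1, so a correlation is at most the number of inputs.
    L₁-gFiber≤ : ∃ λ b → ∀ (C : RandomizedProtocol (Blocks n m₁) (Blocks n m₂) d) → L₁ k (gFiber g (value C)) ≤ b
    L₁-gFiber≤ = ∑ levelₖ (λ _ → ∑₂ xs ys (λ _ _ → 1#) * ∣ c ∣ᵣ) , λ C →
      ∑-mono levelₖ (All.universal (λ I → begin
        ∣ fourier (gFiber g (value C)) I ∣ᵣ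
          ≈⟨ ∣∣-cong (fourier-gFiber g (balanced g vanishing) (value C) I) ⟩
        ∣ correlation g (value C) I * c ∣ᵣ
          ≈⟨ ∣∣-* _ c ⟩
        ∣ correlation g (value C) I ∣ᵣ * ∣ c ∣ᵣ
          ≤⟨ *-monoʳ-≤ (∣x∣-nonNeg c) (≤-trans (∣∑∣≤∑∣∣ xs _) (∑-mono xs (All.universal (λ x →
               ≤-trans (∣∑∣≤∑∣∣ ys _) (∑-mono ys (All.universal (λ y → begin
                 ∣ value C x y * ⟦ χ I (zipWith g x y) ⟧ ∣ᵣ
                   ≈⟨ trans (∣∣-* (value C x y) _) (trans (*-congˡ (∣⟦⟧∣≈1 (χ I (zipWith g x y)))) (*-identityʳ _)) ⟩
                 ∣ value C x y ∣ᵣ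
                   ≤⟨ ∣value∣≤1 C x y ⟩
                 1# ∎) ys))) xs))) ⟩
        ∑₂ xs ys (λ _ _ → 1#) * ∣ c ∣ᵣ ∎) levelₖ)
      where c = ((2# ^ (m₁ ℕ.+ m₂)) ^ n) ⁻¹

    L₁≤L₁-sup : ∀ (C : RandomizedProtocol (Blocks n m₁) (Blocks n m₂) d) → L₁ k (gFiber g (value C)) ≤ L₁-sup k g d n
    L₁≤L₁-sup C = sup-upper
      (proj₁ L₁-gFiber≤ , λ { (C′ , v≈) → ≤-trans (≤-reflexive v≈) (proj₂ L₁-gFiber≤ C′) })
      (C , refl)

    L₁-sup-nonNeg : 0# ≤ L₁-sup k g d n
    L₁-sup-nonNeg = ≤-trans (L₁-nonNeg {n} k (gFiber g (value (constant {d = d})))) (L₁≤L₁-sup constant)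

    fourier-gFiber-cong : ∀ {F F′ : Blocks n m₁ → Blocks n m₂ → Carrier} → (∀ x y → F x y ≈ F′ x y) →
      ∀ I → fourier (gFiber g F) I ≈ fourier (gFiber g F′) I
    fourier-gFiber-cong {F} {F′} F≈F′ I =
      *-congʳ (∑-cong (cube n) (λ z → *-congʳ (*-congʳ (∑-cong (fiber g z) (λ (x , y) → F≈F′ x y)))))

    -- At the pair attaining the maximum, the factor ĝ(S,T)^|I| has absolute value M^k on all of
    -- level k, so it comes out of the sum.
    lift : ∃ λ (lift : RandomizedProtocol (Blocks n 1) (Blocks n 1) d → RandomizedProtocol (Blocks n m₁) (Blocks n m₂) d) →
      ∀ C → L₁ k (gFiber g (value (lift C))) ≈ M ^ k * L₁ k (gFiber XOR (value C))
    lift with M-attained g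
    ... | S , T , M≈ = comapᵣ (parities S) (parities T) , λ C → trans
      (∑-filter-cong (λ I → ∣ I ∣ ℕ.≟ k) (subsets n) (λ { I ≡.refl → begin-equality
        ∣ fourier (gFiber g (value (comapᵣ (parities S) (parities T) C))) I ∣ᵣ
          ≈⟨ ∣∣-cong (trans (fourier-gFiber-cong (value-comapᵣ (parities S) (parities T) C) I)
                            (fourier-parities g vanishing {S} {T} ∑χS≈0 ∑χT≈0 (value C) I)) ⟩
        ∣ gadgetFourier g S T ^ ∣ I ∣ * fourier (gFiber XOR (value C)) I ∣ᵣ
          ≈⟨ ∣∣-* _ _ ⟩
        ∣ gadgetFourier g S T ^ ∣ I ∣ ∣ᵣ * ∣ fourier (gFiber XOR (value C)) I ∣ᵣ
          ≈⟨ *-congʳ (trans (∣∣-^ (gadgetFourier g S T) ∣ I ∣) (^-congˡ ∣ I ∣ (sym M≈))) ⟩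
        M ^ ∣ I ∣ * ∣ fourier (gFiber XOR (value C)) I ∣ᵣ ∎ }))
      (∑-*ˡ levelₖ (M ^ k) _)
      where
      -- An empty S or T would make the maximal coefficient, hence M, zero.
      ST≢⊥ : ¬ (S ≡ ⊥ ⊎ T ≡ ⊥)
      ST≢⊥ ⊥ST = M≉0 g (trans M≈ (trans (∣∣-cong (vanishing S T ⊥ST)) (0≤x⇒∣x∣≈x ≤-refl)))

      ∑χS≈0 : ∑ (cube m₁) (λ u → ⟦ χ S u ⟧) ≈ 0#
      ∑χS≈0 = [ (λ S≡⊥ → contradiction (inj₁ S≡⊥) ST≢⊥) , id ]′ (S≡⊥⊎∑χ≈0 S)

      ∑χT≈0 : ∑ (cube m₂) (λ v → ⟦ χ T v ⟧) ≈ 0#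
      ∑χT≈0 = [ (λ T≡⊥ → contradiction (inj₂ T≡⊥) ST≢⊥) , id ]′ (S≡⊥⊎∑χ≈0 T)

    L₁-sup-XOR≤ : L₁-sup k XOR d n ≤ (M ⁻¹) ^ k * L₁-sup k g d n
    L₁-sup-XOR≤ = sup-least (_ , constant , refl) (λ { {v} (C , v≈) → begin
      v
        ≈⟨ v≈ ⟩
      L₁ k (gFiber XOR (value C))
        ≈⟨ *-identityˡ _ ⟨
      1# * L₁ k (gFiber XOR (value C))
        -- The inserted factor M^k is absorbed by passing from C to its lift.
        ≈⟨ *-congʳ (trans (sym (^-distrib-* (M ⁻¹) M k)) (trans (^-congˡ k (*-inverseˡ (M≉0 g))) (1^ k))) ⟨
      (M ⁻¹) ^ k * M ^ k * L₁ k (gFiber XOR (value C))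
        ≈⟨ *-assoc _ _ _ ⟩
      (M ⁻¹) ^ k * (M ^ k * L₁ k (gFiber XOR (value C)))
        ≈⟨ *-congˡ (proj₂ lift C) ⟨
      (M ⁻¹) ^ k * L₁ k (gFiber g (value (proj₁ lift C)))
        ≤⟨ *-monoˡ-≤ (^-nonNeg k (0≤M⁻¹ g)) (L₁≤L₁-sup (proj₁ lift C)) ⟩
      (M ⁻¹) ^ k * L₁-sup k g d n ∎ })

theorem7p5 :
    (ℝ : Reals) →
    let open Reals ℝ
        open Analysis ℝ
    in
    ∀ {m₁ m₂} (g : Gadget m₁ m₂) →
    (∀ (S : Subset m₁) (T : Subset m₂) → S ≡ ⊥ ⊎ T ≡ ⊥ → gadgetFourier g S T ≈ 0#) →
    ∀ (k d n : ℕ) →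
    (L₁-sup k XOR d n ≤ (maxFourier g ⁻¹) ^ k * L₁-sup k g d n)
    ×
    ((maxFourier g ⁻¹) ^ k * L₁-sup k g d n ≤ √ (2# ^ ((m₁ ℕ.+ m₂) ℕ.* k)) * L₁-sup k g d n)
theorem7p5 ℝ g vanishing k d n =
  L₁-sup-XOR≤ g vanishing k d n ,
  *-monoʳ-≤ (L₁-sup-nonNeg g vanishing k d n) (M⁻¹^k≤√ g k)
  where
  open OrderedField ℝ
  open LargestCoefficient ℝ
  open Randomized ℝ
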